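{- Let $w\in S_\infty$. The set $\mathsf{Decr}_n(w)$ has a normal $\sqrt{\mathfrak{gl}_n}$-crystal structure with weight map $\mathrm{wt}(a)=(\ell(a^1),\dots,\ell(a^n))$ such that $a\in\mathsf{Decr}_n(w)$ is a highest weight element if and only if $\mathsf{tab}(a)$ is an increasing tableau.
   Context: $S_\infty$ is the group of finitely supported permutations of $\mathbb{Z}_{>0}$, $s_i=(i,i+1)$. The Demazure product $\circ$ is the unique associative operation on $S_\infty$ with $s_i\circ s_i=s_i$ and $w\circ s_i=ws_i$ whenever $w(i)<w(i+1)$. A Hecke word for $w$ is a sequence $i_1\cdots i_k$ of positive integers with $w=s_{i_1}\circ\cdots\circ s_{i_k}$. For a fixed positive integer $n$, a decreasing Hecke factorization of $w$ is an $n$-tuple $a=(a^1,\dots,a^n)$ of strictly decreasing (possibly empty) words of positive integers whose concatenation $a^1a^2\cdots a^n$ is a Hecke word for $w$; $\mathsf{Decr}_n(w)$ is the set of these, and $\ell(a^i)$ is the length of $a^i$. $\mathsf{tab}(a)$ is the left-justified tableau whose row $i$ is the reversal of $a^i$. An increasing tableau is a filling of the Young diagram $\{(i,j):1\le j\le\lambda_i\}$ of a partition $\lambda$ by positive integers with strictly increasing rows and columns. Crystal notions: $[n]=\{1,\dots,n\}$, $\mathbf{e}_k$ standard basis of $\mathbb{Z}^n$. A $\sqrt{\mathfrak{gl}_n}$-crystal is a set $\mathcal{B}$ with $\mathrm{wt}:\mathcal{B}\to\mathbb{Z}^n$ and $e_i,f_i:\mathcal{B}\to\mathcal{B}\sqcup\{0\}$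 ($i\in[n-1]$, $e_i(0)=f_i(0)=0$) such that, with $\varepsilon_i(b)=\sup\{k:e_i^k(b)\ne0\}$, $\varphi_i(b)=\sup\{k:f_i^k(b)\neq0\}$: (a) these are finite and $\frac{\varphi_i(b)-\varepsilon_i(b)}{2}=\mathrm{wt}(b)_i-\mathrm{wt}(b)_{i+1}$; (b) $e_i(b)=c$ iff $f_i(c)=b$, and then $\mathrm{wt}(c)-\mathrm{wt}(b)$ is $\mathbf{e}_i$ if $\varepsilon_i(b)$ is even and $-\mathbf{e}_{i+1}$ if odd. Highest weight means $e_i(b)=0$ for all $i$; full subcrystals are weakly connected components of the graph with edges $b\to f_i(b)$; isomorphisms preserve weights and operators. Tensor product: $\mathrm{wt}(b\otimes c)=\mathrm{wt}(b)+\mathrm{wt}(c)$, $e_i(b\otimes c)=b\otimes e_i(c)$ if $\varepsilon_i(b)\le\varphi_i(c)$ else $e_i(b)\otimes c$; $f_i(b\otimes c)=b\otimes f_i(c)$ if $\varepsilon_i(b)<\varphi_i(c)$ else $f_i(b)\otimes c$; $b\otimes 0=0\otimes c=0$. $\mathbb{1}_n$ is a single element of weight $0$ with zero operators. $\mathsf{SS}_n$ is the set of nonempty $S\subseteq[n]$, $\mathrm{wt}(S)=\sum_{j\in S}\mathbf{e}_j$, $e_i(S)=S\cup\{i\}$ if $S\cap\{i,i+1\}=\{i+1\}$, $S\setminus\{i+1\}$ if $S\cap\{i,i+1\}=\{i,i+1\}$, else $0$; $f_i(S)=S\cup\{i+1\}$ if $S\cap\{i,i+1\}=\{i\}$, $S\setminus\{i\}$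 if $S\cap\{i,i+1\}=\{i,i+1\}$, else $0$. A $\sqrt{\mathfrak{gl}_n}$-crystal is normal if every full subcrystal is isomorphic to a full subcrystal of $\mathsf{SS}_n^{\otimes m}$ for some $m\ge0$ ($\mathsf{SS}_n^{\otimes 0}=\mathbb{1}_n$). -}

module Defs where

open import Data.Bool using (Bool; true; false; if_then_else_)
open import Data.Nat as ℕ using (ℕ; zero; suc; _≤_; _<_; _>_; _<ᵇ_; _≤ᵇ_; _≡ᵇ_)
open import Data.Integer as ℤ using (ℤ; +_; -_; -1ℤ; 0ℤ; 1ℤ)
open import Data.Fin as Fin using (Fin; inject₁)
open import Data.Fin.Subset using (Subset; Nonempty)
open import Data.Vec as Vec using (Vec; []; _∷_; lookup; _[_]≔_; toList)
open import Data.Vec.Relation.Unary.All as VAll using ()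
open import Data.List as List using (List; foldl; foldr; _++_; reverse; length)
open import Data.List.Relation.Unary.All as LAll using ()
open import Data.List.Relation.Unary.Linked using (Linked)
open import Data.Maybe as Maybe using (Maybe; just; nothing; is-just)
open import Data.Product using (Σ; _×_)
open import Data.Sum using (_⊎_)
open import Data.Unit using (⊤)
open import Data.Empty using (⊥)
open import Data.Bool using (T)
open import Function using (id)
open import Relation.Binary.PropositionalEquality using (_≡_)
open import Relation.Binary.Construct.Closure.ReflexiveTransitive using (Star)

-- S_∞ : finitely supported permutations of ℤ_{>0}.
-- Encoded as bijections of ℕ fixing 0 (so they restrict to ℤ_{>0}).

record Perm∞ : Set where
  field
    fun       : ℕ → ℕ
    inv       : ℕ → ℕ
    inv-fun   : ∀ j → inv (fun j) ≡ j
    fun-inv   : ∀ j → fun (inv j) ≡ j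
    fix0      : fun 0 ≡ 0
    finiteSupp : Σ ℕ λ N → ∀ j → N ≤ j → fun j ≡ j
open Perm∞ public

swap : ℕ → ℕ → ℕ
swap i j = if j ≡ᵇ i then suc i else (if j ≡ᵇ suc i then i else j)

act : (ℕ → ℕ) → ℕ → (ℕ → ℕ)
act w i = if w i <ᵇ w (suc i) then (λ j → w (swap i j)) else w

demazure : List ℕ → (ℕ → ℕ)
demazure = foldl act id

IsHecke : Perm∞ → List ℕ → Set
IsHecke w word = LAll.All (0 <_) word × (∀ j → demazure word j ≡ fun w j)

IsDecrWord : List ℕ → Set
IsDecrWord a = Linked _>_ a × LAll.All (0 <_) a

concatW : ∀ {n} → Vec (List ℕ) n → List ℕ
concatW a = foldr _++_ List.[] (toList a)

IsDecrFact : ∀ {n} → Perm∞ → Vec (List ℕ) n → Set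
IsDecrFact w a = VAll.All IsDecrWord a × IsHecke w (concatW a)

tab : ∀ {n} → Vec (List ℕ) n → List (List ℕ)
tab a = toList (Vec.map reverse a)

ColStrict : List ℕ → List ℕ → Set
ColStrict _ List.[] = ⊤
ColStrict List.[] (_ List.∷ _) = ⊥
ColStrict (x List.∷ r) (y List.∷ r') = (x < y) × ColStrict r r'

IncreasingTableau : List (List ℕ) → Set
IncreasingTableau rows = LAll.All (Linked _<_) rows × Linked ColStrict rows

-- Crystals.  Rank n = suc k; weights Fin (suc k) → ℤ (coordinate j ↔ paper's j+1);
-- operator index i : Fin k ↔ paper's i+1 ∈ [n-1], acting on coordinates
-- inject₁ i (paper's i) and suc i (paper's i+1).  0 is `nothing`.
-- A crystal is a subset `In` of an ambient type `Elt`.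

record Crystal (k : ℕ) : Set₁ where
  field
    Elt : Set
    In  : Elt → Set
    wt  : Elt → Fin (suc k) → ℤ
    e f : Fin k → Elt → Maybe Elt
open Crystal public

iter : {X : Set} → (X → Maybe X) → ℕ → X → Maybe X
iter g zero x = just x
iter g (suc j) x with g x
... | nothing = nothing
... | just y = iter g j y

IsSup : {X : Set} → (X → Maybe X) → X → ℕ → Set
IsSup g x m = ∀ j → (T (is-just (iter g j x)) → j ≤ m) × (j ≤ m → T (is-just (iter g j x)))

isEven : ℕ → Bool
isEven zero = true
isEven (suc zero) = false
isEven (suc (suc m)) = isEven m

δ : ∀ {k} → Fin k → ℕ → Fin (suc k) → ℤ
δ i me j = if isEven me
  then (if Fin.toℕ j ≡ᵇ Fin.toℕ (inject₁ i) then 1ℤ else 0ℤ)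
  else (if Fin.toℕ j ≡ᵇ Fin.toℕ (Fin.suc i) then -1ℤ else 0ℤ)

record IsCrystal {k : ℕ} (C : Crystal k) : Set where
  field
    e-closed : ∀ i b c → In C b → e C i b ≡ just c → In C c
    f-closed : ∀ i b c → In C b → f C i b ≡ just c → In C c
    ε-finite : ∀ i b → In C b → Σ ℕ (IsSup (e C i) b)
    φ-finite : ∀ i b → In C b → Σ ℕ (IsSup (f C i) b)
    wt-law   : ∀ i b → In C b → ∀ me mf → IsSup (e C i) b me → IsSup (f C i) b mf →
               (+ mf ℤ.- + me) ≡ + 2 ℤ.* (wt C b (inject₁ i) ℤ.- wt C b (Fin.suc i))
    e⇒f      : ∀ i b c → In C b → In C c → e C i b ≡ just c → f C i c ≡ just b
    f⇒e      : ∀ i b c → In C b → In C c → f C i c ≡ just b → e C i b ≡ just c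
    wt-step  : ∀ i b c → In C b → e C i b ≡ just c → ∀ me → IsSup (e C i) b me →
               ∀ j → wt C c j ≡ wt C b j ℤ.+ δ i me j

HighestWeight : ∀ {k} (C : Crystal k) → Elt C → Set
HighestWeight C b = ∀ i → e C i b ≡ nothing

Edge : ∀ {k} (C : Crystal k) → Elt C → Elt C → Set
Edge {k} C x y = In C x × In C y × ((Σ (Fin k) λ i → f C i x ≡ just y) ⊎ (Σ (Fin k) λ i → f C i y ≡ just x))

InComp : ∀ {k} (C : Crystal k) → Elt C → Elt C → Set
InComp C b x = In C x × Star (Edge C) b x

record CompIso {k} (C D : Crystal k) (b : Elt C) (d : Elt D) : Set where
  field
    to      : Elt C → Elt D
    from    : Elt D → Elt C
    to-in   : ∀ x → InComp C b x → InComp D d (to x)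
    from-in : ∀ y → InComp D d y → InComp C b (from y)
    from-to : ∀ x → InComp C b x → from (to x) ≡ x
    to-from : ∀ y → InComp D d y → to (from y) ≡ y
    wt-pres : ∀ x → InComp C b x → ∀ j → wt D (to x) j ≡ wt C x j
    e-pres  : ∀ i x → InComp C b x → e D i (to x) ≡ Maybe.map to (e C i x)
    f-pres  : ∀ i x → InComp C b x → f D i (to x) ≡ Maybe.map to (f C i x)

-- SS_n and its tensor powers (right-nested: SS ⊗ (SS ⊗ (⋯ ⊗ 𝟙)))

ssE : ∀ {k} → Fin k → Subset (suc k) → Maybe (Subset (suc k))
ssE i S with lookup S (inject₁ i) | lookup S (Fin.suc i)
... | false | true = just (S [ inject₁ i ]≔ true)
... | true  | true = just (S [ Fin.suc i ]≔ false)
... | _     | _    = nothing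

ssF : ∀ {k} → Fin k → Subset (suc k) → Maybe (Subset (suc k))
ssF i S with lookup S (inject₁ i) | lookup S (Fin.suc i)
... | true | false = just (S [ Fin.suc i ]≔ true)
... | true | true  = just (S [ inject₁ i ]≔ false)
... | _    | _     = nothing

ssWt : ∀ {k} → Subset (suc k) → Fin (suc k) → ℤ
ssWt S j = if lookup S j then 1ℤ else 0ℤ

count : {X : Set} → ℕ → (X → Maybe X) → X → ℕ
count zero g x = 0
count (suc F) g x with g x
... | nothing = 0
... | just y = suc (count F g y)

-- On SS_n^{⊗m} every e_i/f_i step raises/lowers wt_i - wt_{i+1} ∈ [-m,m] by 1,
-- so ε_i, φ_i ≤ 2m and `count (2m+1)` computes them exactly.
mutual
  tpE : ∀ {k} (m : ℕ) → Fin k → Vec (Subset (suc k)) m → Maybe (Vec (Subset (suc k)) m)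
  tpE zero i [] = nothing
  tpE (suc m) i (S ∷ c) =
    if count 3 (ssE i) S ≤ᵇ count (suc (2 ℕ.* m)) (tpF m i) c
    then Maybe.map (S ∷_) (tpE m i c)
    else Maybe.map (_∷ c) (ssE i S)

  tpF : ∀ {k} (m : ℕ) → Fin k → Vec (Subset (suc k)) m → Maybe (Vec (Subset (suc k)) m)
  tpF zero i [] = nothing
  tpF (suc m) i (S ∷ c) =
    if count 3 (ssE i) S <ᵇ count (suc (2 ℕ.* m)) (tpF m i) c
    then Maybe.map (S ∷_) (tpF m i c)
    else Maybe.map (_∷ c) (ssF i S)

tpWt : ∀ {k m} → Vec (Subset (suc k)) m → Fin (suc k) → ℤ
tpWt [] j = 0ℤ
tpWt (S ∷ c) j = ssWt S j ℤ.+ tpWt c j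

SSTensor : (k m : ℕ) → Crystal k
SSTensor k m = record
  { Elt = Vec (Subset (suc k)) m
  ; In  = VAll.All Nonempty
  ; wt  = tpWt
  ; e   = tpE m
  ; f   = tpF m
  }

Normal : ∀ {k} → Crystal k → Set
Normal {k} C = ∀ b → In C b →
  Σ ℕ λ m → Σ (Vec (Subset (suc k)) m) λ d →
    In (SSTensor k m) d × CompIso C (SSTensor k m) b d

Op : ℕ → Set
Op k = Fin k → Vec (List ℕ) (suc k) → Maybe (Vec (List ℕ) (suc k))

DecrCrystal : (k : ℕ) → Perm∞ → Op k → Op k → Crystal k
DecrCrystal k w eo fo = record
  { Elt = Vec (List ℕ) (suc k)
  ; In  = IsDecrFact w
  ; wt  = λ a j → + length (lookup a j)
  ; e   = eo
  ; f   = fo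
  }

{-# OPTIONS --safe #-}

-- Record a factorization a by the decreasing list J of its letters and, for each letter j,
-- the nonempty set of rows of a containing j. This identifies the factorizations with letters
-- J with SS_n^{⊗|J|}, the largest letter being the leftmost factor. The key point is that the
-- tensor product operators, transported along this bijection, do not change the Hecke product
-- of the concatenated rows: e_i either copies a letter of row i + 1 into row i, or deletes
-- from row i + 1 a letter shared with row i, and the comparison of ε with φ that selects the
-- letter controls exactly which braid relations are available. So the components of Decr_n(w)
-- are literally components of tensor powers, and the vanishing of ε_i is the column condition
-- between rows i and i + 1.
module Submission where

open import Defs
open import Data.Bool using (Bool; true; false; if_then_else_; T)
open import Data.Bool.Properties using (T-≡)
open import Data.Empty using (⊥-elim)
open import Data.Fin as Fin using (Fin; inject₁; toℕ)
open import Data.Fin.Properties using (toℕ-injective; toℕ-inject₁)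
open import Data.Fin.Subset using (Subset; Nonempty)
open import Data.Integer as ℤ using (+_; 1ℤ)
import Data.Integer.Properties as ℤ
import Data.Integer.Tactic.RingSolver as ℤSolver
open import Data.List using (List; []; _∷_; _++_; _∷ʳ_; foldl; length; reverse; filter; downFrom)
open import Data.List.Properties using (foldl-++; ++-assoc; unfold-reverse; length-reverse)
open import Data.List.Membership.Propositional using (_∈_)
open import Data.List.Membership.Propositional.Properties
  using (∈-filter⁺; ∈-filter⁻; ∈-downFrom⁺; ∈-++⁺ˡ; ∈-++⁺ʳ; ∈-++⁻)
open import Data.List.Relation.Unary.All as All using (All; []; _∷_)
import Data.List.Relation.Unary.All.Properties as All
open import Data.List.Relation.Unary.AllPairs using (AllPairs; []; _∷_)
import Data.List.Relation.Unary.AllPairs.Properties as AllPairs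
open import Data.List.Relation.Unary.Any using (here; there)
open import Data.List.Relation.Unary.Linked using (Linked; []; [-]; _∷_)
open import Data.List.Relation.Unary.Linked.Properties using (AllPairs⇒Linked; Linked⇒AllPairs)
open import Data.Maybe as Maybe using (Maybe; just; nothing; is-just)
import Data.Maybe.Properties as Maybe
open import Data.Nat
  using (ℕ; zero; suc; _+_; _*_; _∸_; _≤_; _<_; _>_; z≤n; s≤s; _⊔_; _⊓_; _<ᵇ_; _≤ᵇ_; _≡ᵇ_)
open import Data.Nat.ListAction using (sum)
open import Data.Nat.Properties
open import Data.List.Membership.DecPropositional _≟_ using (_∈?_)
open import Data.Nat.Tactic.RingSolver using (solve-∀)
open import Data.Product using (Σ; ∃; _×_; _,_; proj₁; proj₂)
open import Data.Sum using (_⊎_; inj₁; inj₂)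
open import Data.Vec as Vec using (Vec; []; _∷_; lookup; _[_]≔_; tabulate; toList)
open import Data.Vec.Properties
  using (lookup∘update; lookup∘update′; []≔-idempotent; []≔-lookup; []=⇒lookup; lookup⇒[]=;
         lookup-map; lookup∘tabulate; tabulate∘lookup; tabulate-cong; tabulate-∘)
open import Data.Vec.Relation.Unary.All as VAll using ([]; _∷_)
import Data.Vec.Relation.Unary.All.Properties as VAll
open import Function using (_∘_; id)
open import Function.Bundles using (_⇔_; mk⇔; Equivalence)
open import Relation.Binary.Construct.Closure.ReflexiveTransitive using (Star; _◅_) renaming (ε to done)
open import Relation.Binary.PropositionalEquality
open import Relation.Nullary using (yes; no; does)
open import Relation.Nullary.Decidable using (dec-true)

-- The 0-Hecke action

-- The obstacle is that a raise happens deep inside the word. With the letters peeled off from the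
-- largest down, a letter of row i + 1 that is still outside stands between what remains of the two
-- rows, and a letter of both rows also stands in front. Invariance of the bare two-row product is
-- therefore too weak for induction; it is proved together with its versions in these two contexts.
-- An outer letter h commutes with everything except h - 1, so the only delicate case is h = x + 1
-- with x the next letter. There only the braid relation helps, and it needs a repeated letter. This
-- is what φ detects: if φ of the smaller letters is at most 1, then x cannot lie in row i alone,
-- and a copy of x in both rows supplies the repetition. The thresholds 1 and 2 are the values of ε
-- on {i, i+1} and {i+1}, which is why the tensor product rule asks for exactly these bounds.

≡ᵇ-refl : ∀ n → (n ≡ᵇ n) ≡ true
≡ᵇ-refl zero = refl
≡ᵇ-refl (suc n) = ≡ᵇ-refl n

≢⇒≡ᵇ-false : ∀ {m n} → m ≢ n → (m ≡ᵇ n) ≡ false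
≢⇒≡ᵇ-false {m} {n} m≢n with m ≡ᵇ n in eq
... | false = refl
... | true = ⊥-elim (m≢n (≡ᵇ⇒≡ m n (subst T (sym eq) _)))

swap-left : ∀ i → swap i i ≡ suc i
swap-left i rewrite ≡ᵇ-refl i = refl

swap-right : ∀ i → swap i (suc i) ≡ i
swap-right i rewrite ≢⇒≡ᵇ-false {suc i} {i} 1+n≢n | ≡ᵇ-refl i = refl

swap-other : ∀ i {j} → j ≢ i → j ≢ suc i → swap i j ≡ j
swap-other i j≢i j≢1+i rewrite ≢⇒≡ᵇ-false j≢i | ≢⇒≡ᵇ-false j≢1+i = refl

-- The test in `act` compares two neighbouring values, so `act` sorts positions i and i + 1 into
-- decreasing order. In terms of maximum and minimum the Hecke relations become lattice identities,
-- with no case distinction on the order of the values.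
act-left : ∀ w i → act w i i ≡ w i ⊔ w (suc i)
act-left w i with w i <ᵇ w (suc i) in eq
... | true = trans (cong w (swap-left i))
    (sym (m≤n⇒m⊔n≡n (<⇒≤ (<ᵇ⇒< (w i) (w (suc i)) (subst T (sym eq) _)))))
... | false = sym (m≥n⇒m⊔n≡m (≮⇒≥ λ lt → subst T eq (<⇒<ᵇ lt)))

act-right : ∀ w i → act w i (suc i) ≡ w i ⊓ w (suc i)
act-right w i with w i <ᵇ w (suc i) in eq
... | true = trans (cong w (swap-right i))
    (sym (m≤n⇒m⊓n≡m (<⇒≤ (<ᵇ⇒< (w i) (w (suc i)) (subst T (sym eq) _)))))
... | false = sym (m≥n⇒m⊓n≡n (≮⇒≥ λ lt → subst T eq (<⇒<ᵇ lt)))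

act-other : ∀ w i {j} → j ≢ i → j ≢ suc i → act w i j ≡ w j
act-other w i j≢i j≢1+i with w i <ᵇ w (suc i)
... | true = cong w (swap-other i j≢i j≢1+i)
... | false = refl

data Position (i : ℕ) : ℕ → Set where
  left  : Position i i
  right : Position i (suc i)
  other : ∀ {j} → j ≢ i → j ≢ suc i → Position i j

position : ∀ i j → Position i j
position i j with j ≟ i | j ≟ suc i
... | yes refl | _ = left
... | no _ | yes refl = right
... | no p | no q = other p q

act-cong : ∀ {v w} → v ≗ w → ∀ i → act v i ≗ act w i
act-cong {v} {w} v≗w i j with position i j
... | left = trans (act-left v i) (trans (cong₂ _⊔_ (v≗w i) (v≗w (suc i))) (sym (act-left w i)))
... | right = trans (act-right v i) (trans (cong₂ _⊓_ (v≗w i) (v≗w (suc i))) (sym (act-right w i)))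
... | other p q = trans (act-other v i p q) (trans (v≗w j) (sym (act-other w i p q)))

act-idem : ∀ w i → act (act w i) i ≗ act w i
act-idem w i j with position i j
... | left rewrite act-left (act w i) i | act-left w i | act-right w i =
  m≥n⇒m⊔n≡m (m⊓n≤m⊔n (w i) (w (suc i)))
... | right rewrite act-right (act w i) i | act-left w i | act-right w i =
  m≥n⇒m⊓n≡n (m⊓n≤m⊔n (w i) (w (suc i)))
... | other p q = act-other (act w i) i p q

act-comm : ∀ w {h i} → suc h < i → act (act w i) h ≗ act (act w h) i
act-comm w {h} {i} lt j with position h j
... | left
  rewrite act-left (act w i) h
        | act-other w i (<⇒≢ (<-trans ≤-refl lt)) (<⇒≢ (m<n⇒m<1+n (<-trans ≤-refl lt)))
        | act-other w i (<⇒≢ lt) (<⇒≢ (m<n⇒m<1+n lt))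
        | act-other (act w h) i (<⇒≢ (<-trans ≤-refl lt)) (<⇒≢ (m<n⇒m<1+n (<-trans ≤-refl lt)))
        | act-left w h = refl
... | right
  rewrite act-right (act w i) h
        | act-other w i (<⇒≢ (<-trans ≤-refl lt)) (<⇒≢ (m<n⇒m<1+n (<-trans ≤-refl lt)))
        | act-other w i (<⇒≢ lt) (<⇒≢ (m<n⇒m<1+n lt))
        | act-other (act w h) i (<⇒≢ lt) (<⇒≢ (m<n⇒m<1+n lt))
        | act-right w h = refl
... | other p q with position i j
...   | left
  rewrite act-other (act w i) h p q | act-left w i | act-left (act w h) i
        | act-other w h p q | act-other w h (>⇒≢ (m<n⇒m<1+n (<-trans ≤-refl lt))) (>⇒≢ (m<n⇒m<1+n lt)) = refl
...   | right
  rewrite act-other (act w i) h p q | act-right w i | act-right (act w h) i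
        | act-other w h p q | act-other w h (>⇒≢ (<-trans ≤-refl lt)) (>⇒≢ lt) = refl
...   | other p′ q′
  rewrite act-other (act w i) h p q | act-other w i p′ q′ | act-other (act w h) i p′ q′
        | act-other w h p q = refl

-- Both sides are the median of three numbers: the middle entry left by the two ways of sorting
-- three positions with adjacent comparisons.
⊔-⊓-median : ∀ a b c → (a ⊔ b) ⊓ ((a ⊓ b) ⊔ c) ≡ (a ⊓ (b ⊔ c)) ⊔ (b ⊓ c)
⊔-⊓-median a b c = begin
  (a ⊔ b) ⊓ ((a ⊓ b) ⊔ c)               ≡⟨ ⊓-distribˡ-⊔ (a ⊔ b) (a ⊓ b) c ⟩
  ((a ⊔ b) ⊓ (a ⊓ b)) ⊔ ((a ⊔ b) ⊓ c)   ≡⟨ cong₂ _⊔_ (m≥n⇒m⊓n≡n (m⊓n≤m⊔n a b)) (⊓-distribʳ-⊔ c a b) ⟩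
  (a ⊓ b) ⊔ ((a ⊓ c) ⊔ (b ⊓ c))         ≡⟨ ⊔-assoc (a ⊓ b) (a ⊓ c) (b ⊓ c) ⟨
  ((a ⊓ b) ⊔ (a ⊓ c)) ⊔ (b ⊓ c)         ≡⟨ cong (_⊔ (b ⊓ c)) (⊓-distribˡ-⊔ a b c) ⟨
  (a ⊓ (b ⊔ c)) ⊔ (b ⊓ c)               ∎
  where open ≡-Reasoning

module Braid (w : ℕ → ℕ) (i : ℕ) where
  a b c : ℕ
  a = w i
  b = w (suc i)
  c = w (suc (suc i))

  2+i≢i : suc (suc i) ≢ i
  2+i≢i = >⇒≢ (m<n⇒m<1+n ≤-refl)

  i≢2+i : i ≢ suc (suc i)
  i≢2+i = <⇒≢ (m<n⇒m<1+n ≤-refl)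

  i≢1+i : i ≢ suc i
  i≢1+i = <⇒≢ ≤-refl

  w₁ w₂ v₁ v₂ : ℕ → ℕ
  w₁ = act w i
  w₂ = act w₁ (suc i)
  v₁ = act w (suc i)
  v₂ = act v₁ i

  w₂-0 : w₂ i ≡ a ⊔ b
  w₂-0 = trans (act-other w₁ (suc i) i≢1+i i≢2+i) (act-left w i)
  w₂-1 : w₂ (suc i) ≡ (a ⊓ b) ⊔ c
  w₂-1 = trans (act-left w₁ (suc i)) (cong₂ _⊔_ (act-right w i) (act-other w i 2+i≢i 1+n≢n))
  w₂-2 : w₂ (suc (suc i)) ≡ (a ⊓ b) ⊓ c
  w₂-2 = trans (act-right w₁ (suc i)) (cong₂ _⊓_ (act-right w i) (act-other w i 2+i≢i 1+n≢n))

  v₁-0 : v₁ i ≡ a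
  v₁-0 = act-other w (suc i) i≢1+i i≢2+i
  v₂-0 : v₂ i ≡ a ⊔ (b ⊔ c)
  v₂-0 = trans (act-left v₁ i) (cong₂ _⊔_ v₁-0 (act-left w (suc i)))
  v₂-1 : v₂ (suc i) ≡ a ⊓ (b ⊔ c)
  v₂-1 = trans (act-right v₁ i) (cong₂ _⊓_ v₁-0 (act-left w (suc i)))
  v₂-2 : v₂ (suc (suc i)) ≡ b ⊓ c
  v₂-2 = trans (act-other v₁ i 2+i≢i 1+n≢n) (act-right w (suc i))

  absorb : (a ⊔ b) ⊔ ((a ⊓ b) ⊔ c) ≡ a ⊔ (b ⊔ c)
  absorb = begin
    (a ⊔ b) ⊔ ((a ⊓ b) ⊔ c) ≡⟨ ⊔-assoc (a ⊔ b) (a ⊓ b) c ⟨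
    ((a ⊔ b) ⊔ (a ⊓ b)) ⊔ c ≡⟨ cong (_⊔ c) (m≥n⇒m⊔n≡m (m⊓n≤m⊔n a b)) ⟩
    (a ⊔ b) ⊔ c             ≡⟨ ⊔-assoc a b c ⟩
    a ⊔ (b ⊔ c)             ∎
    where open ≡-Reasoning

  absorb′ : (a ⊓ (b ⊔ c)) ⊓ (b ⊓ c) ≡ (a ⊓ b) ⊓ c
  absorb′ = begin
    (a ⊓ (b ⊔ c)) ⊓ (b ⊓ c) ≡⟨ ⊓-assoc a (b ⊔ c) (b ⊓ c) ⟩
    a ⊓ ((b ⊔ c) ⊓ (b ⊓ c)) ≡⟨ cong (a ⊓_) (m≥n⇒m⊓n≡n (m⊓n≤m⊔n b c)) ⟩
    a ⊓ (b ⊓ c)             ≡⟨ ⊓-assoc a b c ⟨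
    (a ⊓ b) ⊓ c             ∎
    where open ≡-Reasoning

  act-braid : act w₂ i ≗ act v₂ (suc i)
  act-braid j with position i j
  ... | left rewrite act-left w₂ i | act-other v₂ (suc i) i≢1+i i≢2+i | w₂-0 | w₂-1 | v₂-0 = absorb
  ... | right rewrite act-right w₂ i | act-left v₂ (suc i) | w₂-0 | w₂-1 | v₂-1 | v₂-2 = ⊔-⊓-median a b c
  ... | other p q with j ≟ suc (suc i)
  ...   | yes refl rewrite act-other w₂ i p q | act-right v₂ (suc i) | w₂-2 | v₂-1 | v₂-2 = sym absorb′
  ...   | no r rewrite act-other w₂ i p q | act-other w₁ (suc i) q r | act-other w i p q
                     | act-other v₂ (suc i) q r | act-other v₁ i p q | act-other w (suc i) q r = refl

open Braid using (act-braid)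

infix 4 _≈_
-- Quantifying over every starting function, not only `id`, makes this a congruence under prefixing
-- a letter: the prefix merely changes the start.
record _≈_ (u v : List ℕ) : Set where
  constructor mk≈
  field run : ∀ w → foldl act w u ≗ foldl act w v
open _≈_ public

≈-refl : ∀ {u} → u ≈ u
≈-refl = mk≈ λ _ _ → refl

≈-sym : ∀ {u v} → u ≈ v → v ≈ u
≈-sym p = mk≈ λ w j → sym (run p w j)

≈-trans : ∀ {u v x} → u ≈ v → v ≈ x → u ≈ x
≈-trans p q = mk≈ λ w j → trans (run p w j) (run q w j)

≈-∷ : ∀ i {u v} → u ≈ v → i ∷ u ≈ i ∷ v
≈-∷ i p = mk≈ λ w → run p (act w i)

≈-++ˡ : ∀ x {u v} → u ≈ v → x ++ u ≈ x ++ v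
≈-++ˡ [] p = p
≈-++ˡ (i ∷ x) p = ≈-∷ i (≈-++ˡ x p)

foldl-act-cong : ∀ u {v w} → v ≗ w → foldl act v u ≗ foldl act w u
foldl-act-cong [] p = p
foldl-act-cong (i ∷ u) p = foldl-act-cong u (act-cong p i)

≈-++ʳ : ∀ {u v} x → u ≈ v → u ++ x ≈ v ++ x
≈-++ʳ {u} {v} x p = mk≈ λ w j →
  trans (cong-app (foldl-++ act w u x) j)
    (trans (foldl-act-cong x (run p w) j) (cong-app (sym (foldl-++ act w v x)) j))

≈-idem : ∀ i u → i ∷ i ∷ u ≈ i ∷ u
≈-idem i u = mk≈ λ w → foldl-act-cong u (act-idem w i)

≈-comm : ∀ {h i} u → suc h < i → h ∷ i ∷ u ≈ i ∷ h ∷ u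
≈-comm u lt = mk≈ λ w j → sym (foldl-act-cong u (act-comm w lt) j)

≈-braid : ∀ i u → i ∷ suc i ∷ i ∷ u ≈ suc i ∷ i ∷ suc i ∷ u
≈-braid i u = mk≈ λ w → foldl-act-cong u (act-braid w i)

≈-slide : ∀ {h x} u → All (λ y → suc y < h) x → x ++ h ∷ u ≈ h ∷ x ++ u
≈-slide u [] = ≈-refl
≈-slide {x = y ∷ x} u (lt ∷ far) = ≈-trans (≈-∷ y (≈-slide u far)) (≈-comm (x ++ u) lt)

-- Signatures and the invariance of the Hecke product

select : {X : Set} → (X → Bool) → (J : List ℕ) → Vec X (length J) → List ℕ
select p [] [] = []
select p (j ∷ J) (x ∷ c) = if p x then j ∷ select p J c else select p J c

select-All : ∀ {X : Set} {P : ℕ → Set} (p : X → Bool) {J} → All P J → ∀ c → All P (select p J c)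
select-All p [] [] = []
select-All p (Pj ∷ PJ) (x ∷ c) with p x
... | true = Pj ∷ select-All p PJ c
... | false = select-All p PJ c

-- For a fixed operator index i, a factor S is recorded by whether it contains i
-- and whether it contains i + 1.
Signature : ℕ → Set
Signature = Vec (Bool × Bool)

upper lower : (J : List ℕ) → Signature (length J) → List ℕ
upper = select proj₁
lower = select proj₂

-- Positions in the single string {i+1} → {i, i+1} → {i} of `ssE`, counted from its two ends; sets
-- that avoid i and i + 1 get 0.
bitε bitφ : Bool × Bool → ℕ
bitε (_ , false) = 0
bitε (false , true) = 2
bitε (true , true) = 1
bitφ (true , false) = 2
bitφ (true , true) = 1
bitφ (false , _) = 0

-- The closed form of the string lengths of a tensor product, truncated subtraction being the
-- positive part. Agreement with the iterated operators is shown later by `tpE-counts` and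
-- `tpF-counts`.
ε φ : ∀ {m} → Signature m → ℕ
ε [] = 0
ε (s ∷ c) = ε c + (bitε s ∸ φ c)
φ [] = 0
φ (s ∷ c) = bitφ s + (φ c ∸ bitε s)

data RaiseBit : Bool × Bool → Bool × Bool → Set where
  add    : RaiseBit (false , true) (true , true)
  remove : RaiseBit (true , true) (true , false)

-- A relation instead of a function, so that e (left to right) and f (right to left) are two
-- readings of one step. The inequalities are those of the rule for e.
data Raise : ∀ {m} → Signature m → Signature m → Set where
  here  : ∀ {m s s′} {c : Signature m} → φ c < bitε s → RaiseBit s s′ → Raise (s ∷ c) (s′ ∷ c)
  there : ∀ {m s} {c c′ : Signature m} → bitε s ≤ φ c → Raise c c′ → Raise (s ∷ c) (s ∷ c′)

Decreasing : List ℕ → Set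
Decreasing = AllPairs _>_

-- The letter x lies strictly between h and all of J, so h commutes with every letter of J.
gap : ∀ {h x J} → Decreasing (h ∷ x ∷ J) → All (λ y → suc y < h) J
gap ((h>x ∷ _) ∷ x>J ∷ _) = All.map (λ x>y → ≤-<-trans x>y h>x) x>J

module _ {h : ℕ} where
  -- Idempotence at a distance: slide `h` to the front, double it there, slide one copy back.
  far-insert : ∀ {x} u → All (λ y → suc y < h) x → x ++ h ∷ u ≈ h ∷ x ++ h ∷ u
  far-insert u far = ≈-trans (≈-slide u far)
    (≈-trans (≈-sym (≈-idem h _)) (≈-∷ h (≈-sym (≈-slide u far))))

  far-remove : ∀ {x} u → All (λ y → suc y < h) x → h ∷ x ++ h ∷ u ≈ h ∷ x ++ u
  far-remove u far = ≈-trans (≈-∷ h (≈-slide u far)) (≈-idem h _)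

  far-slide : ∀ {x x′ u u′} → All (λ y → suc y < h) x → All (λ y → suc y < h) x′ →
    x ++ u ≈ x′ ++ u′ → x ++ h ∷ u ≈ x′ ++ h ∷ u′
  far-slide {u = u} {u′} far far′ p =
    ≈-trans (≈-slide u far) (≈-trans (≈-∷ h p) (≈-sym (≈-slide u′ far′)))

-- Only a letter x = h - 1 in the upper row could block `h`. The bound on φ excludes x in the upper
-- row alone, and for x in both rows it passes unchanged to the smaller letters.
insert-head : ∀ {h J} (c : Signature (length J)) → Decreasing (h ∷ J) → φ c ≤ 1 →
  upper J c ++ h ∷ lower J c ≈ h ∷ upper J c ++ h ∷ lower J c
insert-head {h} {[]} [] _ _ = ≈-sym (≈-idem h [])
insert-head {h} {x ∷ J} ((false , l) ∷ c) dec _ = far-insert _ (select-All proj₁ (gap dec) c)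
insert-head {h} {x ∷ J} ((true , false) ∷ c) dec (s≤s ())
insert-head {h} {x ∷ J} ((true , true) ∷ c) dec@((h>x ∷ _) ∷ decJ) (s≤s φ≤) with h ≟ suc x
... | no h≢1+x = far-insert _ (≤∧≢⇒< h>x (≢-sym h≢1+x) ∷ select-All proj₁ (gap dec) c)
... | yes refl =
  ≈-trans (≈-∷ x (≈-slide _ far))
  -- The recursive call doubles `x`, not `h`: this creates the pattern `x h x` on which the braid
  -- relation acts.
  (≈-trans (≈-∷ x (≈-∷ h (insert-head c decJ (m∸n≡0⇒m≤n (n≤0⇒n≡0 φ≤)))))
  (≈-trans (≈-braid x _)
  (≈-∷ h (≈-∷ x (≈-sym (≈-slide _ far))))))
  where far = select-All proj₁ (gap dec) c

-- Only the largest letter of `J` can equal h - 1, and if it were in the upper row it would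
-- contribute at least 1 to φ.
φ≡0⇒far : ∀ {h J} (c : Signature (length J)) → Decreasing (h ∷ J) → φ c ≡ 0 →
  All (λ y → suc y < h) (upper J c)
φ≡0⇒far {J = []} [] _ _ = []
φ≡0⇒far {J = x ∷ J} ((false , _) ∷ c) dec _ = select-All proj₁ (gap dec) c
φ≡0⇒far {J = x ∷ J} ((true , false) ∷ c) dec ()
φ≡0⇒far {J = x ∷ J} ((true , true) ∷ c) dec ()

-- Inside a longer word a letter h > J of the lower row separates upper J c from
-- lower J c; `between` and `around` are the cases where h lies in the lower row
-- only and in both rows. Their bounds on φ are those required by `there`.
record Equiv (J : List ℕ) (c c′ : Signature (length J)) : Set where
  field
    product : upper J c ++ lower J c ≈ upper J c′ ++ lower J c′
    between : ∀ {h} → Decreasing (h ∷ J) → 2 ≤ φ c →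
      upper J c ++ h ∷ lower J c ≈ upper J c′ ++ h ∷ lower J c′
    around  : ∀ {h} → Decreasing (h ∷ J) → 1 ≤ φ c →
      h ∷ upper J c ++ h ∷ lower J c ≈ h ∷ upper J c′ ++ h ∷ lower J c′
open Equiv

-- Only `product` has content: the source has φ = 0, so the bounds in the two contexts fail.
Equiv-add : ∀ {x J} {c : Signature (length J)} → Decreasing (x ∷ J) → φ c ≤ 1 →
  Equiv (x ∷ J) ((false , true) ∷ c) ((true , true) ∷ c)
Equiv-add dec φ≤ = record
  { product = insert-head _ dec φ≤
  ; between = λ _ 2≤ → ⊥-elim (<⇒≱ (s≤s z≤n) (≤-trans 2≤ φ≡0))
  ; around  = λ _ 1≤ → ⊥-elim (<⇒≱ (s≤s z≤n) (≤-trans 1≤ φ≡0))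
  }
  where φ≡0 = ≤-reflexive (m≤n⇒m∸n≡0 (≤-trans φ≤ (n≤1+n 1)))

-- The source has φ = 1, which rules out `between` but leaves `around` to be proved.
Equiv-remove : ∀ {x J} {c : Signature (length J)} → Decreasing (x ∷ J) → φ c ≡ 0 →
  Equiv (x ∷ J) ((true , true) ∷ c) ((true , false) ∷ c)
Equiv-remove {x} {J} {c} dec φ≡0 = record
  { product = far-remove _ far
  ; between = λ _ 2≤ → ⊥-elim (<⇒≱ 2≤ (≤-reflexive (cong (λ n → suc (n ∸ 1)) φ≡0)))
  ; around  = around′
  }
  where
  far = φ≡0⇒far c dec φ≡0
  around′ : ∀ {h} → Decreasing (h ∷ x ∷ J) → 1 ≤ φ ((true , true) ∷ c) →
    h ∷ x ∷ upper J c ++ h ∷ x ∷ lower J c ≈ h ∷ x ∷ upper J c ++ h ∷ lower J c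
  around′ {h} dec′@((h>x ∷ _) ∷ _) _ with h ≟ suc x
  ... | no h≢1+x = ≈-∷ h (far-slide far′ far′ (far-remove _ far))
    where far′ = ≤∧≢⇒< h>x (≢-sym h≢1+x) ∷ select-All proj₁ (gap dec′) c
  ... | yes refl =
    ≈-trans (≈-∷ h (≈-∷ x (≈-slide _ far′)))
    -- Turning `h x h` into `x h x` puts a copy of `x` next to the upper row, where it absorbs the
    -- `x` of the lower row; then the braid is undone.
    (≈-trans (≈-sym (≈-braid x _))
    (≈-trans (≈-∷ x (≈-∷ h (far-remove _ far)))
    (≈-trans (≈-braid x _)
    (≈-∷ h (≈-∷ x (≈-sym (≈-slide _ far′)))))))
    where far′ = select-All proj₁ (gap dec′) c

-- The head `x` becomes the context for `J`: (false , true) calls `between`, (true , true) calls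
-- `around`, each with exactly the bound it demands. A further outer letter `h` interacts only with
-- `x`, and only if h = x + 1.
Equiv-∷ : ∀ {x J} s {c c′ : Signature (length J)} → Decreasing (x ∷ J) → bitε s ≤ φ c →
  Equiv J c c′ → Equiv (x ∷ J) (s ∷ c) (s ∷ c′)
Equiv-∷ {x} {J} s {c} {c′} dec ≤φ E = record
  { product = product′ s ≤φ
  ; between = between′
  ; around  = around′
  }
  where
  product′ : ∀ s → bitε s ≤ φ c →
    upper (x ∷ J) (s ∷ c) ++ lower (x ∷ J) (s ∷ c) ≈ upper (x ∷ J) (s ∷ c′) ++ lower (x ∷ J) (s ∷ c′)
  product′ (false , false) _ = product E
  product′ (true , false) _ = ≈-∷ x (product E)
  product′ (false , true) ≤φ = between E dec ≤φ
  product′ (true , true) ≤φ = around E dec ≤φ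

  slides : ∀ {h} → h > x → h ≢ suc x → Decreasing (h ∷ x ∷ J) →
    upper (x ∷ J) (s ∷ c) ++ h ∷ lower (x ∷ J) (s ∷ c) ≈ upper (x ∷ J) (s ∷ c′) ++ h ∷ lower (x ∷ J) (s ∷ c′)
  slides h>x h≢1+x dec′ =
    far-slide (select-All proj₁ far (s ∷ c)) (select-All proj₁ far (s ∷ c′)) (product′ s ≤φ)
    where far = ≤∧≢⇒< h>x (≢-sym h≢1+x) ∷ gap dec′

  module _ (dec′ : Decreasing (suc x ∷ x ∷ J)) where
    far : ∀ c → All (λ y → suc y < suc x) (upper J c)
    far = select-All proj₁ (gap dec′)

    adjacent-between : ∀ s → bitε s ≤ φ c → 2 ≤ φ (s ∷ c) →
      upper (x ∷ J) (s ∷ c) ++ suc x ∷ lower (x ∷ J) (s ∷ c) ≈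
      upper (x ∷ J) (s ∷ c′) ++ suc x ∷ lower (x ∷ J) (s ∷ c′)
    adjacent-between (false , false) _ _ = far-slide (far c) (far c′) (product E)
    adjacent-between (true , false) _ _ = ≈-∷ x (far-slide (far c) (far c′) (product E))
    adjacent-between (false , true) ≤φ _ = far-slide (far c) (far c′) (between E dec ≤φ)
    -- Here φ (s ∷ c) = φ c, because 1 ≤ φ c; so the outer bound 2 is available for `x` as well.
    adjacent-between (true , true) ≤φ 2≤ =
      ≈-∷ x (far-slide (far c) (far c′) (between E dec (≤-trans 2≤ (≤-reflexive (m+[n∸m]≡n ≤φ)))))

    adjacent-around : ∀ s → bitε s ≤ φ c →
      suc x ∷ upper (x ∷ J) (s ∷ c) ++ suc x ∷ lower (x ∷ J) (s ∷ c) ≈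
      suc x ∷ upper (x ∷ J) (s ∷ c′) ++ suc x ∷ lower (x ∷ J) (s ∷ c′)
    adjacent-around (false , false) _ = ≈-∷ (suc x) (far-slide (far c) (far c′) (product E))
    adjacent-around (true , false) _ = ≈-∷ (suc x) (≈-∷ x (far-slide (far c) (far c′) (product E)))
    adjacent-around (false , true) ≤φ = ≈-∷ (suc x) (far-slide (far c) (far c′) (between E dec ≤φ))
    adjacent-around (true , true) ≤φ =
      -- The braid relation leaves `x` both in front of and between the rows of `J`, the situation
      -- of `around` for `x`; afterwards it is reversed.
      ≈-trans (≈-∷ (suc x) (≈-∷ x (≈-slide _ (far c))))
      (≈-trans (≈-sym (≈-braid x _))
      (≈-trans (≈-∷ x (≈-∷ (suc x) (around E dec ≤φ)))
      (≈-trans (≈-braid x _)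
      (≈-∷ (suc x) (≈-∷ x (≈-sym (≈-slide _ (far c′))))))))

  between′ : ∀ {h} → Decreasing (h ∷ x ∷ J) → 2 ≤ φ (s ∷ c) →
    upper (x ∷ J) (s ∷ c) ++ h ∷ lower (x ∷ J) (s ∷ c) ≈ upper (x ∷ J) (s ∷ c′) ++ h ∷ lower (x ∷ J) (s ∷ c′)
  between′ {h} dec′@((h>x ∷ _) ∷ _) 2≤ with h ≟ suc x
  ... | no h≢1+x = slides h>x h≢1+x dec′
  ... | yes refl = adjacent-between dec′ s ≤φ 2≤

  around′ : ∀ {h} → Decreasing (h ∷ x ∷ J) → 1 ≤ φ (s ∷ c) →
    h ∷ upper (x ∷ J) (s ∷ c) ++ h ∷ lower (x ∷ J) (s ∷ c) ≈ h ∷ upper (x ∷ J) (s ∷ c′) ++ h ∷ lower (x ∷ J) (s ∷ c′)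
  around′ {h} dec′@((h>x ∷ _) ∷ _) _ with h ≟ suc x
  ... | no h≢1+x = ≈-∷ h (slides h>x h≢1+x dec′)
  ... | yes refl = adjacent-around dec′ s ≤φ

raise-equiv : ∀ {J} {c c′ : Signature (length J)} → Decreasing J → Raise c c′ → Equiv J c c′
raise-equiv {_ ∷ _} dec (here φ< add) = Equiv-add dec (≤-pred φ<)
raise-equiv {_ ∷ _} dec (here φ< remove) = Equiv-remove dec (n<1⇒n≡0 φ<)
raise-equiv {_ ∷ _} dec@(_ ∷ dec′) (there {s = s} ≤φ r) = Equiv-∷ s dec ≤φ (raise-equiv dec′ r)

-- The operators on tensor powers of SS_n

-- A one-step certificate that yields both the supremum `IsSup` and, given enough fuel, the value of
-- `count`.
Counts : {X : Set} → (X → Maybe X) → (X → ℕ) → Set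
Counts {X} g μ = ∀ x → (g x ≡ nothing × μ x ≡ 0) ⊎ ∃ λ y → g x ≡ just y × μ x ≡ suc (μ y)

module _ {X : Set} {g : X → Maybe X} {μ : X → ℕ} (counts : Counts g μ) where
  Counts⇒IsSup : ∀ x → IsSup g x (μ x)
  Counts⇒IsSup x zero = (λ _ → z≤n) , λ _ → _
  Counts⇒IsSup x (suc j) with g x | counts x
  ... | nothing | inj₁ (_ , μ≡0) = (λ ()) , λ j< → ⊥-elim (<⇒≱ j< (≤-trans (≤-reflexive μ≡0) z≤n))
  ... | just y | inj₂ (_ , refl , μ≡) with Counts⇒IsSup y j
  ...   | p , q = (λ t → subst (suc j ≤_) (sym μ≡) (s≤s (p t))) , λ j< → q (≤-pred (subst (suc j ≤_) μ≡ j<))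

  Counts⇒count : ∀ F x → μ x ≤ F → count F g x ≡ μ x
  Counts⇒count zero x μ≤ = sym (n≤0⇒n≡0 μ≤)
  Counts⇒count (suc F) x μ≤ with g x | counts x
  ... | nothing | inj₁ (_ , μ≡0) = sym μ≡0
  ... | just y | inj₂ (_ , refl , μ≡) =
    trans (cong suc (Counts⇒count F y (≤-pred (subst (_≤ suc F) μ≡ μ≤)))) (sym μ≡)

IsSup-unique : ∀ {X : Set} {g : X → Maybe X} {x m n} → IsSup g x m → IsSup g x n → m ≡ n
IsSup-unique {m = m} {n} p q =
  ≤-antisym (proj₁ (q m) (proj₂ (p m) ≤-refl)) (proj₁ (p n) (proj₂ (q n) ≤-refl))

T⇒≡ : ∀ {b} → T b → b ≡ true
T⇒≡ = Equivalence.to T-≡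

≤⇒≤ᵇ-true : ∀ {m n} → m ≤ n → (m ≤ᵇ n) ≡ true
≤⇒≤ᵇ-true m≤n = T⇒≡ (≤⇒≤ᵇ m≤n)

>⇒≤ᵇ-false : ∀ {m n} → n < m → (m ≤ᵇ n) ≡ false
>⇒≤ᵇ-false {m} {n} n<m with m ≤ᵇ n in eq
... | false = refl
... | true = ⊥-elim (<⇒≱ n<m (≤ᵇ⇒≤ m n (subst T (sym eq) _)))

<⇒<ᵇ-true : ∀ {m n} → m < n → (m <ᵇ n) ≡ true
<⇒<ᵇ-true m<n = T⇒≡ (<⇒<ᵇ m<n)

≥⇒<ᵇ-false : ∀ {m n} → n ≤ m → (m <ᵇ n) ≡ false
≥⇒<ᵇ-false {m} {n} n≤m with m <ᵇ n in eq
... | false = refl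
... | true = ⊥-elim (<⇒≱ (<ᵇ⇒< m n (subst T (sym eq) _)) n≤m)

bitφ≤2 : ∀ s → bitφ s ≤ 2
bitφ≤2 (true , false) = ≤-refl
bitφ≤2 (true , true) = s≤s z≤n
bitφ≤2 (false , _) = z≤n

bitε≤2 : ∀ s → bitε s ≤ 2
bitε≤2 (_ , false) = z≤n
bitε≤2 (true , true) = s≤s z≤n
bitε≤2 (false , true) = ≤-refl

-- Shows that the fuel `suc (2 * m)` in the tensor operators never cuts a count short.
φ≤2*m : ∀ {m} (c : Signature m) → φ c ≤ 2 * m
φ≤2*m [] = z≤n
φ≤2*m {suc m} (s ∷ c) = begin
  bitφ s + (φ c ∸ bitε s) ≤⟨ +-mono-≤ (bitφ≤2 s) (≤-trans (m∸n≤m (φ c) (bitε s)) (φ≤2*m c)) ⟩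
  2 + 2 * m               ≡⟨ *-suc 2 m ⟨
  2 * suc m               ∎
  where open ≤-Reasoning

RaiseBit-counts : ∀ {s s′} → RaiseBit s s′ → bitε s ≡ suc (bitε s′) × bitφ s′ ≡ suc (bitφ s)
RaiseBit-counts add = refl , refl
RaiseBit-counts remove = refl , refl

-- The inequality stored in each constructor keeps one of the two truncated differences at zero
-- before and after the step, while the other summands change by exactly one.
Raise-counts : ∀ {m} {c c′ : Signature m} → Raise c c′ → ε c ≡ suc (ε c′) × φ c′ ≡ suc (φ c)
Raise-counts (here {s = s} {s′} {c} φ< b) with RaiseBit-counts b
... | ε≡ , φ≡ =
  trans (cong (_+_ (ε c)) (trans (cong (_∸ φ c) ε≡) (+-∸-assoc 1 φ≤))) (+-suc (ε c) _) ,
  trans (cong₂ _+_ φ≡ (m≤n⇒m∸n≡0 φ≤)) (cong (λ n → suc (bitφ s + n)) (sym (m≤n⇒m∸n≡0 (<⇒≤ φ<))))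
  where
  φ≤ : φ c ≤ bitε s′
  φ≤ = ≤-pred (subst (φ c <_) ε≡ φ<)
Raise-counts (there {s = s} {c} {c′} ≤φ r) with Raise-counts r
... | ε≡ , φ≡ =
  cong₂ _+_ ε≡ (trans (m≤n⇒m∸n≡0 ≤φ) (sym (m≤n⇒m∸n≡0 (≤-trans ≤φ (≤-trans (n≤1+n _) (≤-reflexive (sym φ≡))))))) ,
  trans (cong (_+_ (bitφ s)) (trans (cong (_∸ bitε s) φ≡) (+-∸-assoc 1 ≤φ))) (+-suc (bitφ s) _)

occurrences : ∀ {X : Set} {m} → (X → Bool) → Vec X m → ℕ
occurrences p [] = 0
occurrences p (x ∷ c) = (if p x then 1 else 0) + occurrences p c

length-select : ∀ {X : Set} (p : X → Bool) J c → length (select p J c) ≡ occurrences p c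
length-select p [] [] = refl
length-select p (j ∷ J) (x ∷ c) with p x
... | true = cong suc (length-select p J c)
... | false = length-select p J c

-- The weight law φ - ε = 2(U - L), with terms moved so that it lives in ℕ. It is additive over
-- factors since the two truncated differences of opposite sign differ by the true difference. It
-- also drives the parity of ε and the highest weight criterion.
balance : ∀ {m} (c : Signature m) → φ c + 2 * occurrences proj₂ c ≡ ε c + 2 * occurrences proj₁ c
balance [] = refl
-- Adding this sum to both sides lets `∸-exchange` trade one truncated difference for the other.
balance ((u , l) ∷ c) = +-cancelˡ-≡ (bitε (u , l) + φ c) _ _ (begin
  (bitε (u , l) + φ c) + ((bitφ (u , l) + (φ c ∸ bitε (u , l))) + 2 * (bit l + L))
    ≡⟨ rearrange (bitε (u , l)) (φ c) (bitφ (u , l)) (φ c ∸ bitε (u , l)) (bit l) L ⟩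
  (bitφ (u , l) + 2 * bit l) + (bitε (u , l) + (φ c ∸ bitε (u , l))) + (φ c + 2 * L)
    ≡⟨ cong₂ _+_ (cong₂ _+_ (bits u l) (∸-exchange (bitε (u , l)) (φ c))) (balance c) ⟩
  (bitε (u , l) + 2 * bit u) + (φ c + (bitε (u , l) ∸ φ c)) + (ε c + 2 * U)
    ≡⟨ rearrange′ (bitε (u , l)) (φ c) (ε c) (bitε (u , l) ∸ φ c) (bit u) U ⟨
  (bitε (u , l) + φ c) + ((ε c + (bitε (u , l) ∸ φ c)) + 2 * (bit u + U)) ∎)
  where
  open ≡-Reasoning
  bit : Bool → ℕ
  bit b = if b then 1 else 0
  U L : ℕ
  U = occurrences proj₁ c
  L = occurrences proj₂ c
  bits : ∀ u l → bitφ (u , l) + 2 * bit l ≡ bitε (u , l) + 2 * bit u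
  bits false false = refl
  bits false true = refl
  bits true false = refl
  bits true true = refl
  ∸-exchange : ∀ m n → m + (n ∸ m) ≡ n + (m ∸ n)
  ∸-exchange zero n = sym (trans (cong (_+_ n) (0∸n≡0 n)) (+-identityʳ n))
  ∸-exchange (suc m) zero = +-identityʳ (suc m)
  ∸-exchange (suc m) (suc n) = cong suc (∸-exchange m n)
  rearrange : ∀ a b x y z t → (a + b) + ((x + y) + 2 * (z + t)) ≡ (x + 2 * z) + (a + y) + (b + 2 * t)
  rearrange = solve-∀
  rearrange′ : ∀ a b x y z t → (a + b) + ((x + y) + 2 * (z + t)) ≡ (a + 2 * z) + (b + y) + (x + 2 * t)
  rearrange′ = solve-∀

isEven-+2* : ∀ n m → isEven (n + 2 * m) ≡ isEven n
isEven-+2* n zero = cong isEven (+-identityʳ n)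
isEven-+2* n (suc m) = trans (cong isEven (rearrange n m)) (isEven-+2* n m)
  where
  rearrange : ∀ n m → n + 2 * suc m ≡ suc (suc (n + 2 * m))
  rearrange = solve-∀

-- By `balance`, ε c and φ c have the same parity. Hence the parity of ε of the whole tensor, which
-- the weight axiom consults, agrees with that of the factor being changed, which decides between
-- adding i and removing i + 1.
ε-head-parity : ∀ {m} s (c : Signature m) → φ c ≤ bitε s → isEven (ε (s ∷ c)) ≡ isEven (bitε s)
ε-head-parity s c φ≤ = begin
  isEven (ε c + (bitε s ∸ φ c))             ≡⟨ isEven-+2* (ε c + (bitε s ∸ φ c)) U ⟨
  isEven (ε c + (bitε s ∸ φ c) + 2 * U)     ≡⟨ cong isEven (swap₂₃ (ε c) (bitε s ∸ φ c) (2 * U)) ⟩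
  isEven (ε c + 2 * U + (bitε s ∸ φ c))     ≡⟨ cong (λ n → isEven (n + (bitε s ∸ φ c))) (balance c) ⟨
  isEven (φ c + 2 * L + (bitε s ∸ φ c))     ≡⟨ cong isEven (swap₂₃ (φ c) (2 * L) (bitε s ∸ φ c)) ⟩
  isEven (φ c + (bitε s ∸ φ c) + 2 * L)     ≡⟨ cong (λ n → isEven (n + 2 * L)) (m+[n∸m]≡n φ≤) ⟩
  isEven (bitε s + 2 * L)                   ≡⟨ isEven-+2* (bitε s) L ⟩
  isEven (bitε s)                           ∎
  where
  open ≡-Reasoning
  U = occurrences proj₁ c
  L = occurrences proj₂ c
  swap₂₃ : ∀ a b c → a + b + c ≡ a + c + b
  swap₂₃ = solve-∀

δ-parity : ∀ {k} (i : Fin k) m n → isEven m ≡ isEven n → ∀ j → δ i m j ≡ δ i n j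
δ-parity i m n eq j rewrite eq = refl

lookup⇒Nonempty : ∀ {n} {S : Subset n} r → lookup S r ≡ true → Nonempty S
lookup⇒Nonempty {S = S} r eq = r , lookup⇒[]= r S eq

module _ {k : ℕ} (i : Fin k) where
  private
    lo hi : Fin (suc k)
    lo = inject₁ i
    hi = Fin.suc i

    lo≢hi : lo ≢ hi
    lo≢hi eq = 1+n≢n (trans (cong toℕ (sym eq)) (toℕ-inject₁ i))

  bits : Subset (suc k) → Bool × Bool
  bits S = lookup S lo , lookup S hi

  signature : ∀ {m} → Vec (Subset (suc k)) m → Signature m
  signature = Vec.map bits

  data RaiseSet (S : Subset (suc k)) : Subset (suc k) → Set where
    add    : bits S ≡ (false , true) → RaiseSet S (S [ lo ]≔ true)
    remove : bits S ≡ (true , true) → RaiseSet S (S [ hi ]≔ false)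

  data RaiseTensor : ∀ {m} → Vec (Subset (suc k)) m → Vec (Subset (suc k)) m → Set where
    here  : ∀ {m S S′} {c : Vec _ m} → φ (signature c) < bitε (bits S) → RaiseSet S S′ →
            RaiseTensor (S ∷ c) (S′ ∷ c)
    there : ∀ {m S} {c c′ : Vec _ m} → bitε (bits S) ≤ φ (signature c) → RaiseTensor c c′ →
            RaiseTensor (S ∷ c) (S ∷ c′)

  bits-add : ∀ S → bits S ≡ (false , true) → bits (S [ lo ]≔ true) ≡ (true , true)
  bits-add S eq = cong₂ _,_ (lookup∘update lo S true)
    (trans (lookup∘update′ (≢-sym lo≢hi) S true) (cong proj₂ eq))

  bits-remove : ∀ S → bits S ≡ (true , true) → bits (S [ hi ]≔ false) ≡ (true , false)
  bits-remove S eq = cong₂ _,_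
    (trans (lookup∘update′ lo≢hi S false) (cong proj₁ eq)) (lookup∘update hi S false)

  RaiseSet⇒RaiseBit : ∀ {S S′} → RaiseSet S S′ → RaiseBit (bits S) (bits S′)
  RaiseSet⇒RaiseBit {S} (add eq) = subst₂ RaiseBit (sym eq) (sym (bits-add S eq)) add
  RaiseSet⇒RaiseBit {S} (remove eq) = subst₂ RaiseBit (sym eq) (sym (bits-remove S eq)) remove

  RaiseTensor⇒Raise : ∀ {m} {d d′ : Vec _ m} → RaiseTensor d d′ → Raise (signature d) (signature d′)
  RaiseTensor⇒Raise (here φ< r) = here φ< (RaiseSet⇒RaiseBit r)
  RaiseTensor⇒Raise (there ≤φ r) = there ≤φ (RaiseTensor⇒Raise r)

  restore : ∀ (S : Subset (suc k)) r {x y} → lookup S r ≡ x → (S [ r ]≔ y) [ r ]≔ x ≡ S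
  restore S r eq = trans ([]≔-idempotent S r) (trans (cong (S [ r ]≔_) (sym eq)) ([]≔-lookup S r))

  ssE-just : ∀ {S S′} → RaiseSet S S′ → ssE i S ≡ just S′
  ssE-just {S} (add eq) with lookup S lo | lookup S hi | eq
  ... | false | true | refl = refl
  ssE-just {S} (remove eq) with lookup S lo | lookup S hi | eq
  ... | true | true | refl = refl

  ssF-just : ∀ {S S′} → RaiseSet S S′ → ssF i S′ ≡ just S
  ssF-just {S} (add eq)
    with lookup (S [ lo ]≔ true) lo | lookup (S [ lo ]≔ true) hi | bits-add S eq
  ... | true | true | refl = cong just (restore S lo (cong proj₁ eq))
  ssF-just {S} (remove eq)
    with lookup (S [ hi ]≔ false) lo | lookup (S [ hi ]≔ false) hi | bits-remove S eq
  ... | true | false | refl = cong just (restore S hi (cong proj₂ eq))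

  ssE-view : ∀ S → (ssE i S ≡ nothing × bitε (bits S) ≡ 0) ⊎ ∃ λ S′ → ssE i S ≡ just S′ × RaiseSet S S′
  ssE-view S with lookup S lo in p | lookup S hi in q
  ... | false | true = inj₂ (_ , refl , add (cong₂ _,_ p q))
  ... | true | true = inj₂ (_ , refl , remove (cong₂ _,_ p q))
  ... | true | false = inj₁ (refl , refl)
  ... | false | false = inj₁ (refl , refl)

  ssF-view : ∀ S → (ssF i S ≡ nothing × bitφ (bits S) ≡ 0) ⊎ ∃ λ S′ → ssF i S ≡ just S′ × RaiseSet S′ S
  ssF-view S with lookup S lo in p | lookup S hi in q
  ... | false | true = inj₁ (refl , refl)
  ... | false | false = inj₁ (refl , refl)
  ... | true | true = inj₂ (_ , refl ,
    subst (RaiseSet _) (restore S lo p) (add (cong₂ _,_ (lookup∘update lo S false)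
      (trans (lookup∘update′ (≢-sym lo≢hi) S false) q))))
  ... | true | false = inj₂ (_ , refl ,
    subst (RaiseSet _) (restore S hi q) (remove (cong₂ _,_
      (trans (lookup∘update′ lo≢hi S true) p) (lookup∘update hi S true))))

  ssE-counts : Counts (ssE i) (λ S → bitε (bits S))
  ssE-counts S with ssE-view S
  ... | inj₁ p = inj₁ p
  ... | inj₂ (S′ , p , r) = inj₂ (S′ , p , proj₁ (RaiseBit-counts (RaiseSet⇒RaiseBit r)))

  count-ssE : ∀ S → count 3 (ssE i) S ≡ bitε (bits S)
  count-ssE S = Counts⇒count ssE-counts 3 S (≤-trans (bitε≤2 (bits S)) (n≤1+n 2))

  FView : ∀ m → Vec (Subset (suc k)) m → Set
  FView m d = (tpF m i d ≡ nothing × φ (signature d) ≡ 0) ⊎ ∃ λ d′ → tpF m i d ≡ just d′ × RaiseTensor d′ d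

  EView : ∀ m → Vec (Subset (suc k)) m → Set
  EView m d = (tpE m i d ≡ nothing × ε (signature d) ≡ 0) ⊎ ∃ λ d′ → tpE m i d ≡ just d′ × RaiseTensor d d′

  FView⇒Counts : ∀ {m} → (∀ d → FView m d) → Counts (tpF m i) (λ d → φ (signature d))
  FView⇒Counts view d with view d
  ... | inj₁ p = inj₁ p
  ... | inj₂ (d′ , p , r) = inj₂ (d′ , p , proj₂ (Raise-counts (RaiseTensor⇒Raise r)))

  -- Parametrised by the view at length m, because that view identifies the fuelled count with φ and
  -- the view at length m + 1 is built from it.
  module Unfold {m} (view : ∀ d → FView m d) (S : Subset (suc k)) (c : Vec (Subset (suc k)) m) where
    count-tpF : count (suc (2 * m)) (tpF m i) c ≡ φ (signature c)
    count-tpF = Counts⇒count (FView⇒Counts view) _ c (m≤n⇒m≤1+n (φ≤2*m (signature c)))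

    tpE-tail : bitε (bits S) ≤ φ (signature c) → tpE (suc m) i (S ∷ c) ≡ Maybe.map (S ∷_) (tpE m i c)
    tpE-tail le rewrite count-ssE S | count-tpF | ≤⇒≤ᵇ-true le = refl

    tpE-head : φ (signature c) < bitε (bits S) → tpE (suc m) i (S ∷ c) ≡ Maybe.map (_∷ c) (ssE i S)
    tpE-head lt rewrite count-ssE S | count-tpF | >⇒≤ᵇ-false lt = refl

    tpF-tail : bitε (bits S) < φ (signature c) → tpF (suc m) i (S ∷ c) ≡ Maybe.map (S ∷_) (tpF m i c)
    tpF-tail lt rewrite count-ssE S | count-tpF | <⇒<ᵇ-true lt = refl

    tpF-head : φ (signature c) ≤ bitε (bits S) → tpF (suc m) i (S ∷ c) ≡ Maybe.map (_∷ c) (ssF i S)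
    tpF-head le rewrite count-ssE S | count-tpF | ≥⇒<ᵇ-false le = refl

  -- The rule for f tests the raised end of a step, the relation its source. Strict and weak
  -- inequality trade places because the step shifts φ of the tail, or `bitε` of the head, by one.
  tpF-view : ∀ {m} d → FView m d
  tpF-view [] = inj₁ (refl , refl)
  tpF-view (S ∷ c) with bitε (bits S) <? φ (signature c) | tpF-view c | ssF-view S
  ... | yes lt | inj₁ (_ , φ≡0) | _ = ⊥-elim (<⇒≱ lt (≤-trans (≤-reflexive φ≡0) z≤n))
  ... | yes lt | inj₂ (c′ , p , r) | _ = inj₂ (S ∷ c′ ,
    trans (Unfold.tpF-tail tpF-view S c lt) (cong (Maybe.map (S ∷_)) p) ,
    there (≤-pred (subst (bitε (bits S) <_) (proj₂ (Raise-counts (RaiseTensor⇒Raise r))) lt)) r)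
  ... | no ≮ | _ | inj₁ (p , φ≡0) = inj₁ (
    trans (Unfold.tpF-head tpF-view S c (≮⇒≥ ≮)) (cong (Maybe.map (_∷ c)) p) ,
    cong₂ _+_ φ≡0 (m≤n⇒m∸n≡0 (≮⇒≥ ≮)))
  ... | no ≮ | _ | inj₂ (S′ , p , r) = inj₂ (S′ ∷ c ,
    trans (Unfold.tpF-head tpF-view S c (≮⇒≥ ≮)) (cong (Maybe.map (_∷ c)) p) ,
    here (subst (φ (signature c) <_) (sym (proj₁ (RaiseBit-counts (RaiseSet⇒RaiseBit r)))) (s≤s (≮⇒≥ ≮))) r)

  tpE-view : ∀ {m} d → EView m d
  tpE-view [] = inj₁ (refl , refl)
  tpE-view (S ∷ c) with bitε (bits S) ≤? φ (signature c) | tpE-view c | ssE-view S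
  ... | yes le | inj₁ (p , ε≡0) | _ = inj₁ (
    trans (Unfold.tpE-tail tpF-view S c le) (cong (Maybe.map (S ∷_)) p) ,
    cong₂ _+_ ε≡0 (m≤n⇒m∸n≡0 le))
  ... | yes le | inj₂ (c′ , p , r) | _ = inj₂ (S ∷ c′ ,
    trans (Unfold.tpE-tail tpF-view S c le) (cong (Maybe.map (S ∷_)) p) , there le r)
  ... | no ≰ | _ | inj₁ (_ , ε≡0) = ⊥-elim (≰ (≤-trans (≤-reflexive ε≡0) z≤n))
  ... | no ≰ | _ | inj₂ (S′ , p , r) = inj₂ (S′ ∷ c ,
    trans (Unfold.tpE-head tpF-view S c (≰⇒> ≰)) (cong (Maybe.map (_∷ c)) p) , here (≰⇒> ≰) r)

  tpE-just : ∀ {m} {d d′ : Vec _ m} → RaiseTensor d d′ → tpE m i d ≡ just d′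
  tpE-just (here {S = S} {c = c} φ< r) = trans (Unfold.tpE-head tpF-view S c φ<) (cong (Maybe.map _) (ssE-just r))
  tpE-just (there {S = S} {c} ≤φ r) = trans (Unfold.tpE-tail tpF-view S c ≤φ) (cong (Maybe.map _) (tpE-just r))

  tpF-just : ∀ {m} {d d′ : Vec _ m} → RaiseTensor d d′ → tpF m i d′ ≡ just d
  tpF-just (here {S′ = S′} {c} φ< r) = trans (Unfold.tpF-head tpF-view S′ c
      (≤-pred (subst (φ (signature c) <_) (proj₁ (RaiseBit-counts (RaiseSet⇒RaiseBit r))) φ<)))
    (cong (Maybe.map _) (ssF-just r))
  tpF-just (there {S = S} {c′ = c′} ≤φ r) = trans (Unfold.tpF-tail tpF-view S c′
      (subst (bitε (bits S) <_) (sym (proj₂ (Raise-counts (RaiseTensor⇒Raise r)))) (s≤s ≤φ)))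
    (cong (Maybe.map _) (tpF-just r))

  tpE⇒Raise : ∀ {m} {d d′ : Vec _ m} → tpE m i d ≡ just d′ → RaiseTensor d d′
  tpE⇒Raise {d = d} eq with tpE-view d
  ... | inj₁ (p , _) with trans (sym p) eq
  ...   | ()
  tpE⇒Raise {d = d} eq | inj₂ (_ , p , r) = subst (RaiseTensor d) (Maybe.just-injective (trans (sym p) eq)) r

  tpF⇒Raise : ∀ {m} {d d′ : Vec _ m} → tpF m i d′ ≡ just d → RaiseTensor d d′
  tpF⇒Raise {d′ = d′} eq with tpF-view d′
  ... | inj₁ (p , _) with trans (sym p) eq
  ...   | ()
  tpF⇒Raise {d′ = d′} eq | inj₂ (_ , p , r) =
    subst (λ d → RaiseTensor d d′) (Maybe.just-injective (trans (sym p) eq)) r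

  tpE-counts : ∀ {m} → Counts (tpE m i) (λ d → ε (signature d))
  tpE-counts d with tpE-view d
  ... | inj₁ p = inj₁ p
  ... | inj₂ (d′ , p , r) = inj₂ (d′ , p , proj₁ (Raise-counts (RaiseTensor⇒Raise r)))

  tpF-counts : ∀ {m} → Counts (tpF m i) (λ d → φ (signature d))
  tpF-counts = FView⇒Counts tpF-view

  RaiseSet-nonempty : ∀ {S S′} → RaiseSet S S′ → Nonempty S × Nonempty S′
  RaiseSet-nonempty {S} (add eq) =
    lookup⇒Nonempty hi (cong proj₂ eq) , lookup⇒Nonempty hi (cong proj₂ (bits-add S eq))
  RaiseSet-nonempty {S} (remove eq) =
    lookup⇒Nonempty hi (cong proj₂ eq) , lookup⇒Nonempty lo (cong proj₁ (bits-remove S eq))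

  raise-nonempty : ∀ {m} {d d′ : Vec _ m} → RaiseTensor d d′ → VAll.All Nonempty d → VAll.All Nonempty d′
  raise-nonempty (here _ r) (_ ∷ ne) = proj₂ (RaiseSet-nonempty r) ∷ ne
  raise-nonempty (there _ r) (n ∷ ne) = n ∷ raise-nonempty r ne

  lower-nonempty : ∀ {m} {d d′ : Vec _ m} → RaiseTensor d d′ → VAll.All Nonempty d′ → VAll.All Nonempty d
  lower-nonempty (here _ r) (_ ∷ ne) = proj₁ (RaiseSet-nonempty r) ∷ ne
  lower-nonempty (there _ r) (n ∷ ne) = n ∷ lower-nonempty r ne

  RaiseSet-wt : ∀ {S S′} → RaiseSet S S′ → ∀ j → ssWt S′ j ≡ ssWt S j ℤ.+ δ i (bitε (bits S)) j
  RaiseSet-wt {S} (add eq) j rewrite eq with j Fin.≟ lo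
  ... | yes refl rewrite ≡ᵇ-refl (toℕ lo) | cong proj₁ eq | lookup∘update lo S true = refl
  ... | no j≢ rewrite ≢⇒≡ᵇ-false (λ e → j≢ (toℕ-injective e)) | lookup∘update′ j≢ S true =
    sym (ℤ.+-identityʳ _)
  RaiseSet-wt {S} (remove eq) j rewrite eq with j Fin.≟ hi
  ... | yes refl rewrite ≡ᵇ-refl (toℕ i) | cong proj₂ eq | lookup∘update hi S false = refl
  ... | no j≢ rewrite ≢⇒≡ᵇ-false {toℕ j} {toℕ hi} (λ e → j≢ (toℕ-injective e)) | lookup∘update′ j≢ S false =
    sym (ℤ.+-identityʳ _)

  raise-wt : ∀ {m} {d d′ : Vec _ m} → RaiseTensor d d′ → ∀ j →
    tpWt d′ j ≡ tpWt d j ℤ.+ δ i (ε (signature d)) j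
  raise-wt {d = S ∷ c} {S′ ∷ _} (here φ< r) j = begin
    ssWt S′ j ℤ.+ tpWt c j                                    ≡⟨ cong (ℤ._+ tpWt c j) (RaiseSet-wt r j) ⟩
    (ssWt S j ℤ.+ δ i (bitε (bits S)) j) ℤ.+ tpWt c j         ≡⟨ ℤ.+-assoc (ssWt S j) _ _ ⟩
    ssWt S j ℤ.+ (δ i (bitε (bits S)) j ℤ.+ tpWt c j)         ≡⟨ cong (ℤ._+_ (ssWt S j)) (ℤ.+-comm _ (tpWt c j)) ⟩
    ssWt S j ℤ.+ (tpWt c j ℤ.+ δ i (bitε (bits S)) j)         ≡⟨ ℤ.+-assoc (ssWt S j) _ _ ⟨
    (ssWt S j ℤ.+ tpWt c j) ℤ.+ δ i (bitε (bits S)) j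
      ≡⟨ cong (ℤ._+_ (ssWt S j ℤ.+ tpWt c j)) (δ-parity i (ε (signature (S ∷ c))) (bitε (bits S))
           (ε-head-parity (bits S) (signature c) (<⇒≤ φ<)) j) ⟨
    (ssWt S j ℤ.+ tpWt c j) ℤ.+ δ i (ε (signature (S ∷ c))) j ∎
    where open ≡-Reasoning
  raise-wt {d = S ∷ c} {_ ∷ c′} (there ≤φ r) j = begin
    ssWt S j ℤ.+ tpWt c′ j                                    ≡⟨ cong (ℤ._+_ (ssWt S j)) (raise-wt r j) ⟩
    ssWt S j ℤ.+ (tpWt c j ℤ.+ δ i (ε (signature c)) j)       ≡⟨ ℤ.+-assoc (ssWt S j) _ _ ⟨
    (ssWt S j ℤ.+ tpWt c j) ℤ.+ δ i (ε (signature c)) j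
      ≡⟨ cong (λ n → ssWt S j ℤ.+ tpWt c j ℤ.+ δ i n j) ε≡ ⟨
    (ssWt S j ℤ.+ tpWt c j) ℤ.+ δ i (ε (signature (S ∷ c))) j ∎
    where
    open ≡-Reasoning
    ε≡ : ε (signature (S ∷ c)) ≡ ε (signature c)
    ε≡ = trans (cong (_+_ (ε (signature c))) (m≤n⇒m∸n≡0 ≤φ)) (+-identityʳ _)

tpWt-occurrences : ∀ {k m} (d : Vec (Subset (suc k)) m) j → tpWt d j ≡ + occurrences (λ S → lookup S j) d
tpWt-occurrences [] j = refl
tpWt-occurrences (S ∷ d) j with lookup S j
... | true = cong (ℤ._+_ 1ℤ) (tpWt-occurrences d j)
... | false = trans (ℤ.+-identityˡ _) (tpWt-occurrences d j)

occurrences-map : ∀ {X Y : Set} {m} (p : Y → Bool) (g : X → Y) (c : Vec X m) →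
  occurrences p (Vec.map g c) ≡ occurrences (λ x → p (g x)) c
occurrences-map p g [] = refl
occurrences-map p g (x ∷ c) = cong (_+_ _) (occurrences-map p g c)

balance-ℤ : ∀ a b u l → a + 2 * l ≡ b + 2 * u → + a ℤ.- + b ≡ + 2 ℤ.* (+ u ℤ.- + l)
balance-ℤ a b u l eq = begin
  + a ℤ.- + b                                          ≡⟨ cong (ℤ._- + b) (shift (+ a) (+ 2 ℤ.* + l)) ⟨
  (+ a ℤ.+ + 2 ℤ.* + l) ℤ.- + 2 ℤ.* + l ℤ.- + b         ≡⟨ cong (λ n → n ℤ.- + 2 ℤ.* + l ℤ.- + b) eqℤ ⟩
  (+ b ℤ.+ + 2 ℤ.* + u) ℤ.- + 2 ℤ.* + l ℤ.- + b         ≡⟨ collect (+ b) (+ u) (+ l) ⟩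
  + 2 ℤ.* (+ u ℤ.- + l)                                ∎
  where
  open ≡-Reasoning
  shift : ∀ x y → (x ℤ.+ y) ℤ.- y ≡ x
  shift = ℤSolver.solve-∀
  collect : ∀ b u l → (b ℤ.+ + 2 ℤ.* u) ℤ.- + 2 ℤ.* l ℤ.- b ≡ + 2 ℤ.* (u ℤ.- l)
  collect = ℤSolver.solve-∀
  eqℤ : + a ℤ.+ + 2 ℤ.* + l ≡ + b ℤ.+ + 2 ℤ.* + u
  eqℤ = begin
    + a ℤ.+ + 2 ℤ.* + l ≡⟨ cong (ℤ._+_ (+ a)) (ℤ.pos-* 2 l) ⟨
    + (a + 2 * l)       ≡⟨ cong +_ eq ⟩
    + (b + 2 * u)       ≡⟨ cong (ℤ._+_ (+ b)) (ℤ.pos-* 2 u) ⟩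
    + b ℤ.+ + 2 ℤ.* + u ∎

SSTensor-isCrystal : ∀ k m → IsCrystal (SSTensor k m)
SSTensor-isCrystal k m = record
  { e-closed = λ i b c In-b eq → raise-nonempty i (tpE⇒Raise i eq) In-b
  ; f-closed = λ i b c In-b eq → lower-nonempty i (tpF⇒Raise i eq) In-b
  ; ε-finite = λ i b _ → _ , Counts⇒IsSup (tpE-counts i) b
  ; φ-finite = λ i b _ → _ , Counts⇒IsSup (tpF-counts i) b
  ; wt-law   = wt-law
  ; e⇒f      = λ i b c _ _ eq → tpF-just i (tpE⇒Raise i eq)
  ; f⇒e      = λ i b c _ _ eq → tpE-just i (tpF⇒Raise i eq)
  ; wt-step  = λ i b c _ eq me sup j → subst (λ n → tpWt c j ≡ tpWt b j ℤ.+ δ i n j)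
                 (IsSup-unique (Counts⇒IsSup (tpE-counts i) b) sup) (raise-wt i (tpE⇒Raise i eq) j)
  }
  where
  wt-law : ∀ i b → VAll.All Nonempty b → ∀ me mf → IsSup (tpE m i) b me → IsSup (tpF m i) b mf →
    + mf ℤ.- + me ≡ + 2 ℤ.* (tpWt b (inject₁ i) ℤ.- tpWt b (Fin.suc i))
  wt-law i b _ me mf sup-e sup-f
    rewrite IsSup-unique sup-e (Counts⇒IsSup (tpE-counts i) b)
          | IsSup-unique sup-f (Counts⇒IsSup (tpF-counts i) b)
          | tpWt-occurrences b (inject₁ i) | tpWt-occurrences b (Fin.suc i)
          | sym (occurrences-map proj₁ (bits i) b) | sym (occurrences-map proj₂ (bits i) b)
    = balance-ℤ (φ (signature i b)) (ε (signature i b))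
        (occurrences proj₁ (signature i b)) (occurrences proj₂ (signature i b)) (balance (signature i b))

-- Factorizations as tensors

select-⊆ : ∀ {X : Set} (p : X → Bool) J c {z} → z ∈ select p J c → z ∈ J
select-⊆ p J c = All.lookup (select-All p (All.tabulate id) c)

select-Decreasing : ∀ {X : Set} (p : X → Bool) {J} → Decreasing J → ∀ c → Decreasing (select p J c)
select-Decreasing p [] [] = []
select-Decreasing p (j>J ∷ dec) (x ∷ c) with p x
... | true = select-All p j>J c ∷ select-Decreasing p dec c
... | false = select-Decreasing p dec c

select-map : ∀ {X Y : Set} (p : Y → Bool) (g : X → Y) J c → select p J (Vec.map g c) ≡ select (p ∘ g) J c
select-map p g [] [] = refl
select-map p g (j ∷ J) (x ∷ c) with p (g x)
... | true = cong (j ∷_) (select-map p g J c)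
... | false = select-map p g J c

row : ∀ {n} → Fin n → (J : List ℕ) → Vec (Subset n) (length J) → List ℕ
row r = select (λ S → lookup S r)

rebuild : ∀ {n} (J : List ℕ) → Vec (Subset n) (length J) → Vec (List ℕ) n
rebuild J d = tabulate (λ r → row r J d)

incidence : ∀ {n} (J : List ℕ) → Vec (List ℕ) n → Vec (Subset n) (length J)
incidence [] a = []
incidence (j ∷ J) a = Vec.map (λ u → does (j ∈? u)) a ∷ incidence J a

-- The sum is a crude upper bound for every letter; filtering `downFrom` lists the distinct letters
-- in decreasing order.
letters : ∀ {n} → Vec (List ℕ) n → List ℕ
letters a = filter (_∈? concatW a) (downFrom (suc (sum (concatW a))))

-- Only letters that occur may become tensor factors, since elements of SS_n are nonempty.
transport : ∀ {n} → (∀ m → Vec (Subset n) m → Maybe (Vec (Subset n) m)) →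
  Vec (List ℕ) n → Maybe (Vec (List ℕ) n)
transport g a = Maybe.map (rebuild (letters a)) (g _ (incidence (letters a) a))

∈⇒≤sum : ∀ {z xs} → z ∈ xs → z ≤ sum xs
∈⇒≤sum {z} {x ∷ xs} (here refl) = m≤m+n x (sum xs)
∈⇒≤sum {z} {x ∷ xs} (there z∈) = ≤-trans (∈⇒≤sum z∈) (m≤n+m (sum xs) x)

∈-concatW⁺ : ∀ {n} (a : Vec (List ℕ) n) r {z} → z ∈ lookup a r → z ∈ concatW a
∈-concatW⁺ (u ∷ a) Fin.zero z∈ = ∈-++⁺ˡ z∈
∈-concatW⁺ (u ∷ a) (Fin.suc r) z∈ = ∈-++⁺ʳ u (∈-concatW⁺ a r z∈)

∈-concatW⁻ : ∀ {n} (a : Vec (List ℕ) n) {z} → z ∈ concatW a → ∃ λ r → z ∈ lookup a r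
∈-concatW⁻ (u ∷ a) z∈ with ∈-++⁻ u z∈
... | inj₁ z∈u = Fin.zero , z∈u
... | inj₂ z∈a with ∈-concatW⁻ a z∈a
...   | r , z∈r = Fin.suc r , z∈r

∈-letters⁺ : ∀ {n} (a : Vec (List ℕ) n) {z} → z ∈ concatW a → z ∈ letters a
∈-letters⁺ a z∈ = ∈-filter⁺ (_∈? concatW a) (∈-downFrom⁺ (s≤s (∈⇒≤sum z∈))) z∈

∈-letters⁻ : ∀ {n} (a : Vec (List ℕ) n) {z} → z ∈ letters a → z ∈ concatW a
∈-letters⁻ a z∈ = proj₂ (∈-filter⁻ (_∈? concatW a) {xs = downFrom (suc (sum (concatW a)))} z∈)

letters-Decreasing : ∀ {n} (a : Vec (List ℕ) n) → Decreasing (letters a)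
letters-Decreasing a = AllPairs.filter⁺ (_∈? concatW a)
  (AllPairs.applyDownFrom⁺₁ id (suc (sum (concatW a))) (λ j<i _ → j<i))

-- Each head is the maximum of the common set of members. This turns the round trips between
-- factorizations and tensors into statements about membership.
Decreasing-ext : ∀ {xs ys} → Decreasing xs → Decreasing ys →
  (∀ {z} → z ∈ xs → z ∈ ys) → (∀ {z} → z ∈ ys → z ∈ xs) → xs ≡ ys
Decreasing-ext {[]} {[]} _ _ _ _ = refl
Decreasing-ext {[]} {y ∷ ys} _ _ _ ⊇ with ⊇ (here refl)
... | ()
Decreasing-ext {x ∷ xs} {[]} _ _ ⊆ _ with ⊆ (here refl)
... | ()
Decreasing-ext {x ∷ xs} {y ∷ ys} (x> ∷ dx) (y> ∷ dy) ⊆ ⊇ =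
  cong₂ _∷_ x≡y (Decreasing-ext dx dy
    (λ z∈ → tail (⊆ (there z∈)) (<⇒≢ (subst (_ <_) x≡y (All.lookup x> z∈))))
    (λ z∈ → tail (⊇ (there z∈)) (<⇒≢ (subst (_ <_) (sym x≡y) (All.lookup y> z∈)))))
  where
  tail : ∀ {z u : ℕ} {us} → z ∈ u ∷ us → z ≢ u → z ∈ us
  tail (here eq) z≢u = ⊥-elim (z≢u eq)
  tail (there z∈) _ = z∈
  x≡y : x ≡ y
  x≡y with ⊆ (here refl) | ⊇ (here refl)
  ... | here eq | _ = eq
  ... | there _ | here eq = sym eq
  ... | there x∈ | there y∈ = ⊥-elim (<-asym (All.lookup y> x∈) (All.lookup x> y∈))

lookup-ext : ∀ {X : Set} {n} {u v : Vec X n} → (∀ r → lookup u r ≡ lookup v r) → u ≡ v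
lookup-ext {u = u} {v} eq = trans (sym (tabulate∘lookup u)) (trans (tabulate-cong eq) (tabulate∘lookup v))

row-incidence : ∀ {n} (a : Vec (List ℕ) n) r J → row r J (incidence J a) ≡ filter (_∈? lookup a r) J
row-incidence a r [] = refl
row-incidence a r (j ∷ J) rewrite lookup-map r (λ u → does (j ∈? u)) a with does (j ∈? lookup a r)
... | true = cong (j ∷_) (row-incidence a r J)
... | false = row-incidence a r J

rebuild-incidence : ∀ {n} (a : Vec (List ℕ) n) {J} → Decreasing J → (∀ r → Decreasing (lookup a r)) →
  (∀ {z} r → z ∈ lookup a r → z ∈ J) → rebuild J (incidence J a) ≡ a
rebuild-incidence a {J} decJ dec-a ⊆J = trans
  (tabulate-cong λ r → trans (row-incidence a r J)
    (Decreasing-ext (AllPairs.filter⁺ (_∈? lookup a r) decJ) (dec-a r)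
      (λ z∈ → proj₂ (∈-filter⁻ (_∈? lookup a r) {xs = J} z∈))
      (λ z∈ → ∈-filter⁺ (_∈? lookup a r) (⊆J r z∈) z∈)))
  (tabulate∘lookup a)

-- Membership is compared only for letters of `J`: on passing to the tail this excludes the removed
-- letter `j`, which may still occur in the rows of `a`.
incidence-unique : ∀ {n} (a : Vec (List ℕ) n) {J} → Decreasing J → (d : Vec (Subset n) (length J)) →
  (∀ r {z} → z ∈ J → z ∈ lookup a r → z ∈ row r J d) →
  (∀ r {z} → z ∈ J → z ∈ row r J d → z ∈ lookup a r) → incidence J a ≡ d
incidence-unique a [] [] _ _ = refl
incidence-unique a {j ∷ J} (j>J ∷ dec) (S ∷ d) ⊆ ⊇ = cong₂ _∷_ (lookup-ext head) (incidence-unique a dec d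
    (λ r z∈ z∈a → row-tail r z∈ (⊆ r (there z∈) z∈a))
    (λ r z∈ z∈d → ⊇ r (there z∈) (row-there r z∈d)))
  where
  row-there : ∀ r {z} → z ∈ row r J d → z ∈ row r (j ∷ J) (S ∷ d)
  row-there r z∈ with lookup S r
  ... | true = there z∈
  ... | false = z∈
  row-tail : ∀ r {z} → z ∈ J → z ∈ row r (j ∷ J) (S ∷ d) → z ∈ row r J d
  row-tail r z∈ z∈d with lookup S r
  row-tail r z∈ (there z∈d) | true = z∈d
  row-tail r z∈ (here refl) | true = ⊥-elim (<-irrefl refl (All.lookup j>J z∈))
  ... | false = z∈d
  head-⊆ : ∀ r → j ∈ row r (j ∷ J) (S ∷ d) → lookup S r ≡ true
  head-⊆ r j∈ with lookup S r
  ... | true = refl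
  ... | false = ⊥-elim (<-irrefl refl (All.lookup j>J (select-⊆ (λ S → lookup S r) J d j∈)))
  head-⊇ : ∀ r → lookup S r ≡ true → j ∈ row r (j ∷ J) (S ∷ d)
  head-⊇ r eq rewrite eq = here refl
  head : ∀ r → lookup (Vec.map (λ u → does (j ∈? u)) a) r ≡ lookup S r
  head r rewrite lookup-map r (λ u → does (j ∈? u)) a with j ∈? lookup a r
  ... | yes j∈ = sym (head-⊆ r (⊆ r (here refl) j∈))
  ... | no j∉ with lookup S r in eq
  ...   | false = refl
  ...   | true = ⊥-elim (j∉ (⊇ r (here refl) (head-⊇ r eq)))

incidence-rebuild : ∀ {n J} → Decreasing J → (d : Vec (Subset n) (length J)) → incidence J (rebuild J d) ≡ d
incidence-rebuild {J = J} dec d = incidence-unique (rebuild J d) dec d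
  (λ r _ → subst (_ ∈_) (lookup∘tabulate (λ r → row r J d) r))
  (λ r _ → subst (_ ∈_) (sym (lookup∘tabulate (λ r → row r J d) r)))

∈-row : ∀ {n J} (d : Vec (Subset n) (length J)) → VAll.All Nonempty d → ∀ {z} → z ∈ J → ∃ λ r → z ∈ row r J d
∈-row {J = j ∷ J} (S ∷ d) ((r , r∈S) ∷ _) (here refl) = r , head
  where
  head : j ∈ row r (j ∷ J) (S ∷ d)
  head rewrite []=⇒lookup r∈S = here refl
∈-row {J = j ∷ J} (S ∷ d) (_ ∷ ne) {z} (there z∈) with ∈-row d ne z∈
... | r , z∈r = r , tail
  where
  tail : z ∈ row r (j ∷ J) (S ∷ d)
  tail with lookup S r
  ... | true = there z∈r
  ... | false = z∈r

letters-rebuild : ∀ {n J} → Decreasing J → (d : Vec (Subset n) (length J)) → VAll.All Nonempty d →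
  letters (rebuild J d) ≡ J
letters-rebuild {n} {J} dec d ne = Decreasing-ext (letters-Decreasing (rebuild J d)) dec ⊆ ⊇
  where
  lookup-row : ∀ r → lookup (rebuild J d) r ≡ row r J d
  lookup-row = lookup∘tabulate (λ r → row r J d)
  ⊆ : ∀ {z} → z ∈ letters (rebuild J d) → z ∈ J
  ⊆ z∈ with ∈-concatW⁻ (rebuild J d) (∈-letters⁻ (rebuild J d) z∈)
  ... | r , z∈r = select-⊆ (λ S → lookup S r) J d (subst (_ ∈_) (lookup-row r) z∈r)
  ⊇ : ∀ {z} → z ∈ J → z ∈ letters (rebuild J d)
  ⊇ z∈ with ∈-row d ne z∈
  ... | r , z∈r = ∈-letters⁺ (rebuild J d) (∈-concatW⁺ (rebuild J d) r (subst (_ ∈_) (sym (lookup-row r)) z∈r))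

-- `transport` recomputes the alphabet at every application. Nonemptiness of the factors makes it
-- come out as `J` again, so iterates and whole components stay in one tensor power.
transport-rebuild : ∀ {n J} (g : ∀ m → Vec (Subset n) m → Maybe (Vec (Subset n) m)) → Decreasing J →
  (d : Vec (Subset n) (length J)) → VAll.All Nonempty d →
  transport g (rebuild J d) ≡ Maybe.map (rebuild J) (g _ d)
transport-rebuild {J = J} g dec d ne = trans
  (cong (λ K → Maybe.map (rebuild K) (g _ (incidence K (rebuild J d)))) (letters-rebuild dec d ne))
  (cong (λ e → Maybe.map (rebuild J) (g _ e)) (incidence-rebuild dec d))

incidence-nonempty : ∀ {n} (a : Vec (List ℕ) n) J → (∀ {z} → z ∈ J → ∃ λ r → z ∈ lookup a r) →
  VAll.All Nonempty (incidence J a)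
incidence-nonempty a [] _ = []
incidence-nonempty a (j ∷ J) occurs = nonempty (occurs (here refl)) ∷ incidence-nonempty a J (occurs ∘ there)
  where
  nonempty : (∃ λ r → j ∈ lookup a r) → Nonempty (Vec.map (λ u → does (j ∈? u)) a)
  nonempty (r , j∈) = lookup⇒Nonempty r
    (trans (lookup-map r (λ u → does (j ∈? u)) a) (dec-true (j ∈? lookup a r) j∈))

record Alphabet (J : List ℕ) : Set where
  field
    decreasing : Decreasing J
    positive   : All (0 <_) J
open Alphabet public

data Rebuilt {n} : Vec (List ℕ) n → Set where
  rebuilt : ∀ {J} → Alphabet J → (d : Vec (Subset n) (length J)) → VAll.All Nonempty d → Rebuilt (rebuild J d)

letters-Alphabet : ∀ {n} {a : Vec (List ℕ) n} → VAll.All IsDecrWord a → Alphabet (letters a)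
letters-Alphabet {a = a} words = record
  { decreasing = letters-Decreasing a
  ; positive   = All.tabulate λ z∈ → let r , z∈r = ∈-concatW⁻ a (∈-letters⁻ a z∈) in
                   All.lookup (proj₂ (VAll.lookup⁺ words r)) z∈r
  }

letters-nonempty : ∀ {n} (a : Vec (List ℕ) n) → VAll.All Nonempty (incidence (letters a) a)
letters-nonempty a = incidence-nonempty a (letters a) (∈-concatW⁻ a ∘ ∈-letters⁻ a)

rebuild-letters : ∀ {n} {a : Vec (List ℕ) n} → VAll.All IsDecrWord a →
  rebuild (letters a) (incidence (letters a) a) ≡ a
rebuild-letters {a = a} words = rebuild-incidence a (letters-Decreasing a)
  (λ r → Linked⇒AllPairs (λ x>y y>z → <-trans y>z x>y) (proj₁ (VAll.lookup⁺ words r)))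
  (λ r z∈ → ∈-letters⁺ a (∈-concatW⁺ a r z∈))

rebuilt-view : ∀ {n} {a : Vec (List ℕ) n} → VAll.All IsDecrWord a → Rebuilt a
rebuilt-view {a = a} words = subst Rebuilt (rebuild-letters words)
  (rebuilt (letters-Alphabet words) (incidence (letters a) a) (letters-nonempty a))

rebuild-words : ∀ {n J} → Alphabet J → (d : Vec (Subset n) (length J)) → VAll.All IsDecrWord (rebuild J d)
rebuild-words alphabet d = VAll.tabulate⁺ λ r →
  AllPairs⇒Linked (select-Decreasing (λ S → lookup S r) (decreasing alphabet) d) ,
  select-All (λ S → lookup S r) (positive alphabet) d

concatW-positive : ∀ {n} {a : Vec (List ℕ) n} → VAll.All IsDecrWord a → All (0 <_) (concatW a)
concatW-positive [] = []
concatW-positive ((_ , pos) ∷ words) = All.++⁺ pos (concatW-positive words)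

-- The two rows are adjacent in the concatenation, so their equivalence extends by congruence. Rows
-- are given as functions so that the induction on `i` is a shift of the index.
concatW-cong₂ : ∀ {k} (i : Fin k) (g h : Fin (suc k) → List ℕ) →
  g (inject₁ i) ++ g (Fin.suc i) ≈ h (inject₁ i) ++ h (Fin.suc i) →
  (∀ r → r ≢ inject₁ i → r ≢ Fin.suc i → g r ≡ h r) → concatW (tabulate g) ≈ concatW (tabulate h)
concatW-cong₂ Fin.zero g h eq rest =
  subst₂ _≈_ (++-assoc (g Fin.zero) _ _)
    (trans (cong (λ t → (h Fin.zero ++ h (Fin.suc Fin.zero)) ++ concatW t)
       (tabulate-cong λ r → rest (Fin.suc (Fin.suc r)) (λ ()) (λ ())))
      (++-assoc (h Fin.zero) _ _))
    (≈-++ʳ (concatW (tabulate (g ∘ Fin.suc ∘ Fin.suc))) eq)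
concatW-cong₂ (Fin.suc i) g h eq rest =
  subst (λ u → g Fin.zero ++ concatW (tabulate (g ∘ Fin.suc)) ≈ u ++ concatW (tabulate (h ∘ Fin.suc)))
    (rest Fin.zero (λ ()) (λ ()))
    (≈-++ˡ (g Fin.zero) (concatW-cong₂ i (g ∘ Fin.suc) (h ∘ Fin.suc) eq
      (λ r p q → rest (Fin.suc r) (p ∘ suc-inj) (q ∘ suc-inj))))
  where
  suc-inj : ∀ {n} {x y : Fin n} → Fin.suc x ≡ Fin.suc y → x ≡ y
  suc-inj refl = refl

raise-lookup : ∀ {k} (i : Fin k) {S S′} → RaiseSet i S S′ → ∀ r → r ≢ inject₁ i → r ≢ Fin.suc i →
  lookup S r ≡ lookup S′ r
raise-lookup i {S} (add _) r p q = sym (lookup∘update′ p S true)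
raise-lookup i {S} (remove _) r p q = sym (lookup∘update′ q S false)

raise-row : ∀ {k} (i : Fin k) J {d d′} → RaiseTensor i d d′ → ∀ r → r ≢ inject₁ i → r ≢ Fin.suc i →
  row r J d ≡ row r J d′
raise-row i (j ∷ J) {_ ∷ c} (here _ s) r p q =
  cong (λ b → if b then j ∷ row r J c else row r J c) (raise-lookup i s r p q)
raise-row i (j ∷ J) {S ∷ _} (there _ s) r p q =
  cong (λ u → if lookup S r then j ∷ u else u) (raise-row i J s r p q)

raise-concatW : ∀ {k} (i : Fin k) {J d d′} → Decreasing J → RaiseTensor i d d′ →
  concatW (rebuild J d) ≈ concatW (rebuild J d′)
raise-concatW i {J} {d} {d′} dec s = concatW-cong₂ i (λ r → row r J d) (λ r → row r J d′)
  (subst₂ _≈_ (rows d) (rows d′) (Equiv.product (raise-equiv dec (RaiseTensor⇒Raise i s))))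
  (raise-row i J s)
  where
  rows : ∀ d → upper J (signature i d) ++ lower J (signature i d) ≡ row (inject₁ i) J d ++ row (Fin.suc i) J d
  rows d = cong₂ _++_ (select-map proj₁ (bits i) J d) (select-map proj₂ (bits i) J d)

IsDecrFact-≈ : ∀ {n w J} {d d′ : Vec (Subset n) (length J)} → Alphabet J →
  concatW (rebuild J d) ≈ concatW (rebuild J d′) → IsDecrFact w (rebuild J d) → IsDecrFact w (rebuild J d′)
IsDecrFact-≈ {d′ = d′} alphabet eq (_ , _ , hecke) =
  rebuild-words alphabet d′ , concatW-positive (rebuild-words alphabet d′) ,
  λ j → trans (sym (run eq id j)) (hecke j)

-- The column condition

ColStrict-∷ʳˡ⁺ : ∀ X {Y h} → ColStrict X Y → ColStrict (X ∷ʳ h) Y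
ColStrict-∷ʳˡ⁺ X {[]} _ = _
ColStrict-∷ʳˡ⁺ (x ∷ X) {y ∷ Y} (x<y , cs) = x<y , ColStrict-∷ʳˡ⁺ X cs

-- The appended `h` supports nothing: an entry below it would have to exceed `h`.
ColStrict-∷ʳˡ⁻ : ∀ X {Y h} → All (_≤ h) Y → ColStrict (X ∷ʳ h) Y → ColStrict X Y
ColStrict-∷ʳˡ⁻ X {[]} _ _ = _
ColStrict-∷ʳˡ⁻ [] {y ∷ Y} (y≤h ∷ _) (h<y , _) = <⇒≱ h<y y≤h
ColStrict-∷ʳˡ⁻ (x ∷ X) {y ∷ Y} (_ ∷ ≤h) (x<y , cs) = x<y , ColStrict-∷ʳˡ⁻ X ≤h cs

ColStrict-∷ʳʳ⁺ : ∀ {X Y h} → All (_< h) X → ColStrict X Y → length Y < length X → ColStrict X (Y ∷ʳ h)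
ColStrict-∷ʳʳ⁺ {x ∷ X} {[]} (x<h ∷ _) _ _ = x<h , _
ColStrict-∷ʳʳ⁺ {x ∷ X} {y ∷ Y} (_ ∷ <h) (x<y , cs) (s≤s lt) = x<y , ColStrict-∷ʳʳ⁺ <h cs lt

ColStrict-∷ʳʳ⁻ : ∀ X Y {h} → ColStrict X (Y ∷ʳ h) → ColStrict X Y × length Y < length X
ColStrict-∷ʳʳ⁻ [] [] ()
ColStrict-∷ʳʳ⁻ [] (y ∷ Y) ()
ColStrict-∷ʳʳ⁻ (x ∷ X) [] _ = _ , s≤s z≤n
ColStrict-∷ʳʳ⁻ (x ∷ X) (y ∷ Y) (x<y , cs) with ColStrict-∷ʳʳ⁻ X Y cs
... | cs′ , lt = (x<y , cs′) , s≤s lt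

All-reverse : ∀ {P : ℕ → Set} {xs} → All P xs → All P (reverse xs)
All-reverse [] = []
All-reverse {P} {x ∷ xs} (px ∷ pxs) = subst (All P) (sym (unfold-reverse x xs)) (All.∷ʳ⁺ (All-reverse pxs) px)

-- At ε = 0 this says φ = 2(U - L), an even number. So 1 ≤ φ and 2 ≤ φ both mean L < U, and the two
-- kinds of factor containing i + 1 impose the same condition on row lengths.
φ-highest : ∀ {m} (c : Signature m) → ε c ≡ 0 → φ c + 2 * occurrences proj₂ c ≡ 2 * occurrences proj₁ c
φ-highest c ε≡0 = trans (balance c) (cong (_+ 2 * occurrences proj₁ c) ε≡0)

module _ {m} (c : Signature m) (ε≡0 : ε c ≡ 0) where
  private
    U L : ℕ
    U = occurrences proj₁ c
    L = occurrences proj₂ c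

  φ≥1⇒L<U : 1 ≤ φ c → L < U
  φ≥1⇒L<U 1≤φ = *-cancelˡ-< 2 L U (subst (2 * L <_) (φ-highest c ε≡0) (+-monoˡ-≤ (2 * L) 1≤φ))

  L<U⇒φ≥2 : L < U → 2 ≤ φ c
  L<U⇒φ≥2 L<U = +-cancelʳ-≤ (2 * L) 2 (φ c)
    (subst₂ _≤_ (*-suc 2 L) (sym (φ-highest c ε≡0)) (*-monoʳ-≤ 2 L<U))

module _ (J : List ℕ) (c : Signature (length J)) where
  upperʳ lowerʳ : List ℕ
  upperʳ = reverse (upper J c)
  lowerʳ = reverse (lower J c)

  length-upperʳ : length upperʳ ≡ occurrences proj₁ c
  length-upperʳ = trans (length-reverse (upper J c)) (length-select proj₁ J c)

  length-lowerʳ : length lowerʳ ≡ occurrences proj₂ c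
  length-lowerʳ = trans (length-reverse (lower J c)) (length-select proj₂ J c)

-- Adding the largest letter `j` appends it to the reversed rows. In the lower row it needs an entry
-- above it, which amounts to L < U, hence to φ ≥ 2; in the upper row it has nothing below it.
ColStrict⇒ε≡0 : ∀ {J} → Decreasing J → ∀ c → ColStrict (upperʳ J c) (lowerʳ J c) → ε c ≡ 0
ColStrict⇒ε≡0 [] [] _ = refl
ColStrict⇒ε≡0 {j ∷ J} (j>J ∷ dec) ((u , l) ∷ c) = go u l
  where
  U = upperʳ J c
  L = lowerʳ J c
  L<j : All (_< j) L
  L<j = All-reverse (select-All proj₂ j>J c)
  matched : ∀ {s} → 2 ∸ φ c ≡ 0 → bitε s ∸ φ c ≡ 0
  matched {s} p = m≤n⇒m∸n≡0 (≤-trans (bitε≤2 s) (m∸n≡0⇒m≤n {2} {φ c} p))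
  enough : ColStrict U (L ∷ʳ j) → ε c ≡ 0 × 2 ∸ φ c ≡ 0
  enough cs with ColStrict-∷ʳʳ⁻ U L cs
  ... | cs′ , lt = ε≡0 , m≤n⇒m∸n≡0 (L<U⇒φ≥2 c ε≡0 (subst₂ _<_ (length-lowerʳ J c) (length-upperʳ J c) lt))
    where ε≡0 = ColStrict⇒ε≡0 dec c cs′
  go : ∀ u l → ColStrict (upperʳ (j ∷ J) ((u , l) ∷ c)) (lowerʳ (j ∷ J) ((u , l) ∷ c)) → ε ((u , l) ∷ c) ≡ 0
  go false false cs = cong₂ _+_ (ColStrict⇒ε≡0 dec c cs) (0∸n≡0 (φ c))
  go true false cs rewrite unfold-reverse j (upper J c) =
    cong₂ _+_ (ColStrict⇒ε≡0 dec c (ColStrict-∷ʳˡ⁻ U (All.map <⇒≤ L<j) cs)) (0∸n≡0 (φ c))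
  go false true cs rewrite unfold-reverse j (lower J c) =
    let ε≡0 , p = enough cs in cong₂ _+_ ε≡0 p
  -- No entry of the lower row exceeds `j`, its own last entry included, so the upper `j` can be
  -- stripped first, leaving the case of `j` in the lower row alone.
  go true true cs rewrite unfold-reverse j (lower J c) | unfold-reverse j (upper J c) =
    let ε≡0 , p = enough (ColStrict-∷ʳˡ⁻ U (All.∷ʳ⁺ (All.map <⇒≤ L<j) ≤-refl) cs) in
    cong₂ _+_ ε≡0 (matched {true , true} p)

ε≡0⇒ColStrict : ∀ {J} → Decreasing J → ∀ c → ε c ≡ 0 → ColStrict (upperʳ J c) (lowerʳ J c)
ε≡0⇒ColStrict [] [] _ = _
ε≡0⇒ColStrict {j ∷ J} (j>J ∷ dec) ((u , l) ∷ c) ε≡0 = go u l (m∸n≡0⇒m≤n (m+n≡0⇒n≡0 (ε c) ε≡0))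
  where
  U = upperʳ J c
  L = lowerʳ J c
  εc≡0 : ε c ≡ 0
  εc≡0 = m+n≡0⇒m≡0 (ε c) ε≡0
  ih : ColStrict U L
  ih = ε≡0⇒ColStrict dec c εc≡0
  below : 1 ≤ φ c → ColStrict U (L ∷ʳ j)
  below 1≤φ = ColStrict-∷ʳʳ⁺ (All-reverse (select-All proj₁ j>J c)) ih
    (subst₂ _<_ (sym (length-lowerʳ J c)) (sym (length-upperʳ J c)) (φ≥1⇒L<U c εc≡0 1≤φ))
  go : ∀ u l → bitε (u , l) ≤ φ c → ColStrict (upperʳ (j ∷ J) ((u , l) ∷ c)) (lowerʳ (j ∷ J) ((u , l) ∷ c))
  go false false _ = ih
  go true false _ rewrite unfold-reverse j (upper J c) = ColStrict-∷ʳˡ⁺ U ih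
  go false true 2≤φ rewrite unfold-reverse j (lower J c) = below (≤-trans (s≤s z≤n) 2≤φ)
  go true true 1≤φ rewrite unfold-reverse j (lower J c) | unfold-reverse j (upper J c) =
    ColStrict-∷ʳˡ⁺ U (below 1≤φ)

Linked-tabulate : ∀ {X : Set} {R : X → X → Set} {k} (g : Fin (suc k) → X) →
  Linked R (toList (tabulate g)) ⇔ (∀ i → R (g (inject₁ i)) (g (Fin.suc i)))
Linked-tabulate {R = R} g = mk⇔ (to g) (from g)
  where
  to : ∀ {k} (g : Fin (suc k) → _) → Linked R (toList (tabulate g)) → ∀ i → R (g (inject₁ i)) (g (Fin.suc i))
  to g (r ∷ _) Fin.zero = r
  to g (_ ∷ rs) (Fin.suc i) = to (g ∘ Fin.suc) rs i
  from : ∀ {k} (g : Fin (suc k) → _) → (∀ i → R (g (inject₁ i)) (g (Fin.suc i))) → Linked R (toList (tabulate g))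
  from {zero} g _ = [-]
  from {suc k} g r = r Fin.zero ∷ from (g ∘ Fin.suc) (r ∘ Fin.suc)

Linked-∷ʳ : ∀ {xs h} → Linked _<_ xs → All (_< h) xs → Linked _<_ (xs ∷ʳ h)
Linked-∷ʳ [] _ = [-]
Linked-∷ʳ [-] (x<h ∷ _) = x<h ∷ [-]
Linked-∷ʳ (x<y ∷ inc) (_ ∷ <h) = x<y ∷ Linked-∷ʳ inc <h

reverse-Increasing : ∀ {xs} → Decreasing xs → Linked _<_ (reverse xs)
reverse-Increasing [] = []
reverse-Increasing {x ∷ xs} (x> ∷ dec) =
  subst (Linked _<_) (sym (unfold-reverse x xs)) (Linked-∷ʳ (reverse-Increasing dec) (All-reverse x>))

All-toList-tabulate : ∀ {X : Set} {P : X → Set} {n} (g : Fin n → X) → (∀ r → P (g r)) → All P (toList (tabulate g))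
All-toList-tabulate {n = zero} g p = []
All-toList-tabulate {n = suc n} g p = p Fin.zero ∷ All-toList-tabulate (g ∘ Fin.suc) (p ∘ Fin.suc)

module _ {k : ℕ} {J : List ℕ} (dec : Decreasing J) (d : Vec (Subset (suc k)) (length J)) where
  rowʳ : Fin (suc k) → List ℕ
  rowʳ r = reverse (row r J d)

  tab-rebuild : tab (rebuild J d) ≡ toList (tabulate rowʳ)
  tab-rebuild = cong toList (sym (tabulate-∘ reverse (λ r → row r J d)))

  upperʳ-signature : ∀ i → upperʳ J (signature i d) ≡ rowʳ (inject₁ i)
  upperʳ-signature i = cong reverse (select-map proj₁ (bits i) J d)

  lowerʳ-signature : ∀ i → lowerʳ J (signature i d) ≡ rowʳ (Fin.suc i)
  lowerʳ-signature i = cong reverse (select-map proj₂ (bits i) J d)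

  tab-increasing⇔ : IncreasingTableau (tab (rebuild J d)) ⇔ (∀ i → ε (signature i d) ≡ 0)
  tab-increasing⇔ rewrite tab-rebuild = mk⇔
    (λ (_ , cols) i → ColStrict⇒ε≡0 dec (signature i d)
      (subst₂ ColStrict (sym (upperʳ-signature i)) (sym (lowerʳ-signature i))
        (Equivalence.to (Linked-tabulate rowʳ) cols i)))
    (λ ε≡0 → All-toList-tabulate rowʳ (λ r → reverse-Increasing (select-Decreasing (λ S → lookup S r) dec d)) ,
      Equivalence.from (Linked-tabulate rowʳ) λ i →
        subst₂ ColStrict (upperʳ-signature i) (lowerʳ-signature i) (ε≡0⇒ColStrict dec (signature i d) (ε≡0 i)))

-- The crystal Decr_n(w)

Partial : ℕ → Set
Partial n = ∀ m → Vec (Subset n) m → Maybe (Vec (Subset n) m)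

-- The hypothesis `closed` keeps every iterate nonempty, so that `transport-rebuild` applies again
-- after each step.
module Transport {n} (g : Partial n)
  (closed : ∀ {m} {d d′ : Vec (Subset n) m} → VAll.All Nonempty d → g m d ≡ just d′ → VAll.All Nonempty d′)
  {J : List ℕ} (dec : Decreasing J) where

  transport-just : ∀ {d a} → VAll.All Nonempty d → transport g (rebuild J d) ≡ just a →
    ∃ λ d′ → g _ d ≡ just d′ × a ≡ rebuild J d′
  transport-just {d} ne eq with g _ d | trans (sym (transport-rebuild g dec d ne)) eq
  ... | just d′ | refl = d′ , refl , refl

  transport-just⁺ : ∀ {d d′} → VAll.All Nonempty d → g _ d ≡ just d′ → transport g (rebuild J d) ≡ just (rebuild J d′)
  transport-just⁺ {d} ne eq = trans (transport-rebuild g dec d ne) (cong (Maybe.map (rebuild J)) eq)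

  iter-transport : ∀ j d → VAll.All Nonempty d →
    iter (transport g) j (rebuild J d) ≡ Maybe.map (rebuild J) (iter (g _) j d)
  iter-transport zero d ne = refl
  iter-transport (suc j) d ne rewrite transport-rebuild g dec d ne with g _ d in eq
  ... | nothing = refl
  ... | just d′ = iter-transport j d′ (closed ne eq)

  is-just-iter : ∀ j d → VAll.All Nonempty d → is-just (iter (transport g) j (rebuild J d)) ≡ is-just (iter (g _) j d)
  is-just-iter j d ne rewrite iter-transport j d ne with iter (g _) j d
  ... | nothing = refl
  ... | just _ = refl

  IsSup-transport : ∀ {d m} → VAll.All Nonempty d → IsSup (g _) d m → IsSup (transport g) (rebuild J d) m
  IsSup-transport {d} {m} ne sup j =
    (proj₁ (sup j) ∘ subst T (is-just-iter j d ne)) , (subst T (sym (is-just-iter j d ne)) ∘ proj₂ (sup j))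

  IsSup-transport⁻ : ∀ {d m} → VAll.All Nonempty d → IsSup (transport g) (rebuild J d) m → IsSup (g _) d m
  IsSup-transport⁻ {d} {m} ne sup j =
    (proj₁ (sup j) ∘ subst T (sym (is-just-iter j d ne))) , (subst T (is-just-iter j d ne) ∘ proj₂ (sup j))

module Decr (k : ℕ) (w : Perm∞) where
  eo fo : Op k
  eo i = transport (λ m → tpE m i)
  fo i = transport (λ m → tpF m i)

  B : Crystal k
  B = DecrCrystal k w eo fo

  module _ (i : Fin k) {J : List ℕ} (alphabet : Alphabet J) where
    open Transport (λ m → tpE m i) (λ ne eq → raise-nonempty i (tpE⇒Raise i eq) ne) (decreasing alphabet) public
      using () renaming
        (transport-just to e-just; transport-just⁺ to e-just⁺; IsSup-transport to ε-sup; IsSup-transport⁻ to ε-sup⁻)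
    open Transport (λ m → tpF m i) (λ ne eq → lower-nonempty i (tpF⇒Raise i eq) ne) (decreasing alphabet) public
      using () renaming
        (transport-just to f-just; transport-just⁺ to f-just⁺; IsSup-transport to φ-sup; IsSup-transport⁻ to φ-sup⁻)

  wt-rebuild : ∀ J d j → wt B (rebuild J d) j ≡ tpWt d j
  wt-rebuild J d j = begin
    ℤ.+ length (lookup (rebuild J d) j)                ≡⟨ cong (ℤ.+_ ∘ length) (lookup∘tabulate (λ r → row r J d) j) ⟩
    ℤ.+ length (row j J d)                             ≡⟨ cong ℤ.+_ (length-select (λ S → lookup S j) J d) ⟩
    ℤ.+ occurrences (λ S → lookup S j) d               ≡⟨ tpWt-occurrences d j ⟨
    tpWt d j                                           ∎
    where
    open ≡-Reasoning

  view : ∀ {a} → In B a → Rebuilt a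
  view (words , _) = rebuilt-view words

  raise-In : ∀ i {J} (alphabet : Alphabet J) {d d′} → RaiseTensor i d d′ → In B (rebuild J d) → In B (rebuild J d′)
  raise-In i alphabet s = IsDecrFact-≈ {w = w} alphabet (raise-concatW i (decreasing alphabet) s)

  lower-In : ∀ i {J} (alphabet : Alphabet J) {d d′} → RaiseTensor i d d′ → In B (rebuild J d′) → In B (rebuild J d)
  lower-In i alphabet s = IsDecrFact-≈ {w = w} alphabet (≈-sym (raise-concatW i (decreasing alphabet) s))

  isCrystal : IsCrystal B
  isCrystal = record
    { e-closed = e-closed; f-closed = f-closed
    ; ε-finite = ε-finite; φ-finite = φ-finite
    ; wt-law = wt-law
    ; e⇒f = e⇒f; f⇒e = f⇒e
    ; wt-step = wt-step
    }
    where
    module SS {m} = IsCrystal (SSTensor-isCrystal k m)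

    e-closed : ∀ i b c → In B b → eo i b ≡ just c → In B c
    e-closed i b c In-b eq with view In-b
    ... | rebuilt {J} alphabet d ne with e-just i alphabet ne eq
    ...   | d′ , p , refl = raise-In i alphabet (tpE⇒Raise i p) In-b

    f-closed : ∀ i b c → In B b → fo i b ≡ just c → In B c
    f-closed i b c In-b eq with view In-b
    ... | rebuilt {J} alphabet d ne with f-just i alphabet ne eq
    ...   | d′ , p , refl = lower-In i alphabet (tpF⇒Raise i p) In-b

    ε-finite : ∀ i b → In B b → Σ ℕ (IsSup (eo i) b)
    ε-finite i b In-b with view In-b
    ... | rebuilt alphabet d ne = _ , ε-sup i alphabet ne (proj₂ (SS.ε-finite i d ne))

    φ-finite : ∀ i b → In B b → Σ ℕ (IsSup (fo i) b)
    φ-finite i b In-b with view In-b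
    ... | rebuilt alphabet d ne = _ , φ-sup i alphabet ne (proj₂ (SS.φ-finite i d ne))

    wt-law : ∀ i b → In B b → ∀ me mf → IsSup (eo i) b me → IsSup (fo i) b mf →
      ℤ.+ mf ℤ.- ℤ.+ me ≡ ℤ.+ 2 ℤ.* (wt B b (inject₁ i) ℤ.- wt B b (Fin.suc i))
    wt-law i b In-b me mf sup-e sup-f with view In-b
    ... | rebuilt {J} alphabet d ne =
      subst₂ (λ x y → ℤ.+ mf ℤ.- ℤ.+ me ≡ ℤ.+ 2 ℤ.* (x ℤ.- y))
        (sym (wt-rebuild J d (inject₁ i))) (sym (wt-rebuild J d (Fin.suc i)))
        (SS.wt-law i d ne me mf (ε-sup⁻ i alphabet ne sup-e) (φ-sup⁻ i alphabet ne sup-f))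

    e⇒f : ∀ i b c → In B b → In B c → eo i b ≡ just c → fo i c ≡ just b
    e⇒f i b c In-b _ eq with view In-b
    ... | rebuilt alphabet d ne with e-just i alphabet ne eq
    ...   | d′ , p , refl = let s = tpE⇒Raise i p in f-just⁺ i alphabet (raise-nonempty i s ne) (tpF-just i s)

    f⇒e : ∀ i b c → In B b → In B c → fo i c ≡ just b → eo i b ≡ just c
    f⇒e i b c _ In-c eq with view In-c
    ... | rebuilt alphabet d ne with f-just i alphabet ne eq
    ...   | d′ , p , refl = let s = tpF⇒Raise i p in e-just⁺ i alphabet (lower-nonempty i s ne) (tpE-just i s)

    wt-step : ∀ i b c → In B b → eo i b ≡ just c → ∀ me → IsSup (eo i) b me →
      ∀ j → wt B c j ≡ wt B b j ℤ.+ δ i me j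
    wt-step i b c In-b eq me sup j with view In-b
    ... | rebuilt {J} alphabet d ne with e-just i alphabet ne eq
    ...   | d′ , p , refl = subst₂ (λ x y → x ≡ y ℤ.+ δ i me j)
      (sym (wt-rebuild J d′ j)) (sym (wt-rebuild J d j))
      (SS.wt-step i d d′ ne p me (ε-sup⁻ i alphabet ne sup) j)

  module _ {J : List ℕ} (alphabet : Alphabet J) where
    private
      D : Crystal k
      D = SSTensor k (length J)

    -- Every element of the component is rebuilt from the same `J`; this is what lets `incidence J`
    -- and `rebuild J`, with `J` fixed, serve as the isomorphism.
    path-down : ∀ {d y} → In D d → Star (Edge B) (rebuild J d) y →
      ∃ λ d′ → y ≡ rebuild J d′ × In D d′ × Star (Edge D) d d′
    path-down {d} ne done = d , refl , ne , done
    path-down {d} ne ((_ , _ , inj₁ (i , eq)) ◅ path) with f-just i alphabet ne eq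
    ... | d₁ , p , refl with lower-nonempty i (tpF⇒Raise i p) ne
    ...   | ne₁ with path-down ne₁ path
    ...     | d′ , y≡ , ne′ , path′ = d′ , y≡ , ne′ , (ne , ne₁ , inj₁ (i , p)) ◅ path′
    -- An edge traversed against f gives no equation for f at the known end; `f⇒e` turns it into a
    -- step of e from there.
    path-down {d} ne ((In-b , In-c , inj₂ (i , eq)) ◅ path)
      with e-just i alphabet ne (IsCrystal.f⇒e isCrystal i _ _ In-b In-c eq)
    ... | d₁ , p , refl with raise-nonempty i (tpE⇒Raise i p) ne
    ...   | ne₁ with path-down ne₁ path
    ...     | d′ , y≡ , ne′ , path′ = d′ , y≡ , ne′ , (ne , ne₁ , inj₂ (i , tpF-just i (tpE⇒Raise i p))) ◅ path′

    path-up : ∀ {d d′} → In D d → In B (rebuild J d) → Star (Edge D) d d′ → InComp B (rebuild J d) (rebuild J d′)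
    path-up ne In-b done = In-b , done
    path-up ne In-b ((_ , ne₁ , inj₁ (i , p)) ◅ path) =
      let In-c = lower-In i alphabet (tpF⇒Raise i p) In-b
          In-y , path′ = path-up ne₁ In-c path
      in In-y , (In-b , In-c , inj₁ (i , f-just⁺ i alphabet ne p)) ◅ path′
    path-up ne In-b ((_ , ne₁ , inj₂ (i , p)) ◅ path) =
      let In-c = raise-In i alphabet (tpF⇒Raise i p) In-b
          In-y , path′ = path-up ne₁ In-c path
      in In-y , (In-b , In-c , inj₂ (i , f-just⁺ i alphabet ne₁ p)) ◅ path′

    map-incidence-rebuild : ∀ (x : Maybe (Elt D)) → Maybe.map (incidence J) (Maybe.map (rebuild J) x) ≡ x
    map-incidence-rebuild nothing = refl
    map-incidence-rebuild (just d) = cong just (incidence-rebuild (decreasing alphabet) d)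

    component-iso : ∀ {d} → In D d → In B (rebuild J d) → CompIso B D (rebuild J d) d
    component-iso {d} ne In-b = record
      { to = incidence J
      ; from = rebuild J
      ; to-in = to-in
      ; from-in = λ y (_ , path) → path-up ne In-b path
      ; from-to = λ x (_ , path) → let _ , x≡ , _ = path-down ne path in from-to x≡
      ; to-from = λ y _ → incidence-rebuild (decreasing alphabet) y
      ; wt-pres = wt-pres
      ; e-pres = λ i → op-pres (λ m → tpE m i)
      ; f-pres = λ i → op-pres (λ m → tpF m i)
      }
      where
      incidence≡ : ∀ {x d′} → x ≡ rebuild J d′ → incidence J x ≡ d′
      incidence≡ refl = incidence-rebuild (decreasing alphabet) _

      from-to : ∀ {x d′} → x ≡ rebuild J d′ → rebuild J (incidence J x) ≡ x
      from-to x≡ = trans (cong (rebuild J) (incidence≡ x≡)) (sym x≡)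

      to-in : ∀ x → InComp B (rebuild J d) x → InComp D d (incidence J x)
      to-in x (_ , path) with path-down ne path
      ... | d′ , x≡ , ne′ , path′ = subst (InComp D d) (sym (incidence≡ x≡)) (ne′ , path′)

      wt-pres : ∀ x → InComp B (rebuild J d) x → ∀ j → tpWt (incidence J x) j ≡ wt B x j
      wt-pres x (_ , path) j with path-down ne path
      ... | d′ , refl , _ = trans (cong (λ e → tpWt e j) (incidence≡ refl)) (sym (wt-rebuild J d′ j))

      op-pres : ∀ (g : Partial (suc k)) x → InComp B (rebuild J d) x →
        g _ (incidence J x) ≡ Maybe.map (incidence J) (transport g x)
      op-pres g x (_ , path) with path-down ne path
      ... | d′ , refl , ne′ , _ = begin
        g _ (incidence J (rebuild J d′))                           ≡⟨ cong (g _) (incidence≡ refl) ⟩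
        g _ d′                                                     ≡⟨ map-incidence-rebuild (g _ d′) ⟨
        Maybe.map (incidence J) (Maybe.map (rebuild J) (g _ d′))
          ≡⟨ cong (Maybe.map (incidence J)) (transport-rebuild g (decreasing alphabet) d′ ne′) ⟨
        Maybe.map (incidence J) (transport g (rebuild J d′))       ∎
        where open ≡-Reasoning

  normal : Normal B
  normal b In-b with view In-b
  ... | rebuilt {J} alphabet d ne = length J , d , ne , component-iso alphabet ne In-b

  highest⇔ : ∀ {J} (alphabet : Alphabet J) {d} → VAll.All Nonempty d →
    HighestWeight B (rebuild J d) ⇔ (∀ i → ε (signature i d) ≡ 0)
  highest⇔ {J} alphabet {d} ne = mk⇔ to from
    where
    to : HighestWeight B (rebuild J d) → ∀ i → ε (signature i d) ≡ 0
    to hw i with tpE-view i d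
    ... | inj₁ (_ , ε≡0) = ε≡0
    ... | inj₂ (d′ , p , _) with trans (sym (hw i)) (e-just⁺ i alphabet ne p)
    ...   | ()
    from : (∀ i → ε (signature i d) ≡ 0) → HighestWeight B (rebuild J d)
    from ε≡0 i with tpE-view i d
    ... | inj₁ (p , _) = trans (transport-rebuild (λ m → tpE m i) (decreasing alphabet) d ne) (Maybe.map-nothing p)
    ... | inj₂ (d′ , _ , s) with trans (sym (ε≡0 i)) (proj₁ (Raise-counts (RaiseTensor⇒Raise i s)))
    ...   | ()

theorem1p10 : (k : ℕ) (w : Perm∞) →
    Σ (Op k) λ eo → Σ (Op k) λ fo →
      IsCrystal (DecrCrystal k w eo fo) × Normal (DecrCrystal k w eo fo) ×
      (∀ a → IsDecrFact w a →
        (HighestWeight (DecrCrystal k w eo fo) a → IncreasingTableau (tab a)) ×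
        (IncreasingTableau (tab a) → HighestWeight (DecrCrystal k w eo fo) a))
theorem1p10 k w = eo , fo , isCrystal , normal , highest
  where
  open Decr k w
  highest : ∀ a → IsDecrFact w a →
    (HighestWeight B a → IncreasingTableau (tab a)) × (IncreasingTableau (tab a) → HighestWeight B a)
  highest a In-a with view In-a
  ... | rebuilt alphabet d ne =
    Equivalence.from tableau ∘ Equivalence.to weight , Equivalence.from weight ∘ Equivalence.to tableau
    where
    tableau = tab-increasing⇔ (decreasing alphabet) d
    weight = highest⇔ alphabet ne
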